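{- Given an instance of \textsc{OraclePureCircuit} with $|V|$ nodes, any algorithm that has black-box oracle access to $\mathcal{L}$ and outputs a solution to \textsc{OraclePureCircuit} requires $2^{\Omega(|V|^{1/3})}$ queries to $\mathcal{L}$ (in the worst case).
   Context: \textsc{OraclePureCircuit}: An instance is given by a natural number $N$, a finite set of nodes $V$ (with $N\le|V|$), three sets of gates $\mathcal{G}_{\textsc{Nor}}$, $\mathcal{G}_{\textsc{Purify}}$, $\mathcal{G}_{\textsc{Oracle}}$, and oracle access to a function $\mathcal{L}:\{0,1\}^N\to\{0,1\}$. Each gate is a tuple of distinct nodes: $(u,v,w)\in\mathcal{G}_{\textsc{Nor}}$ has inputs $u,v$ and output $w$; $(u,v,w)\in\mathcal{G}_{\textsc{Purify}}$ has input $u$ and outputs $v,w$; $(u_1,\dots,u_N,v)\in\mathcal{G}_{\textsc{Oracle}}$ has inputs $u_1,\dots,u_N$ and output $v$. Each node is the output of exactly one gate. A solution is an assignment $b:V\to\{0,1,\bot\}$ satisfying all gates: for $(u,v,w)\in\mathcal{G}_{\textsc{Nor}}$, $b(u)=b(v)=0\implies b(w)=1$, and ($b(u)=1$ or $b(v)=1$) $\implies b(w)=0$; for $(u,v,w)\in\mathcal{G}_{\textsc{Purify}}$, $\{b(v),b(w)\}\cap\{0,1\}\ne\emptyset$, and $b(u)\in\{0,1\}\implies b(v)=b(w)=b(u)$; for $(u_1,\dots,u_N,v)\in\mathcal{G}_{\textsc{Oracle}}$, $(b(u_1),\dots,b(u_N))\in\{0,1\}^N\implies b(v)=\mathcal{L}(b(u_1),\dots,b(u_N))$.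 -}

module Defs where

open import Data.Nat using (ℕ; zero; suc; _+_; _*_; _^_; _≤_; _<_)
open import Data.Bool using (Bool; true; false)
open import Data.Fin using (Fin)
open import Data.Vec using (Vec; toList)
open import Data.List using (List; []; _∷_; _++_; concatMap)
open import Data.List.Membership.Propositional using (_∈_)
open import Data.List.Relation.Unary.All using (All)
open import Data.List.Relation.Unary.Unique.Propositional using (Unique)
open import Data.Product using (_×_; Σ; _,_)
open import Relation.Binary.PropositionalEquality using (_≡_)

data Val : Set where
  v0 v1 v⊥ : Val

bit : Bool → Val
bit false = v0
bit true  = v1

data IsBit : Val → Set where
  isBit : (x : Bool) → IsBit (bit x)

record Instance (n N : ℕ) : Set where
  field
    N≤V      : N ≤ n
    norGates    : List (Fin n × Fin n × Fin n)          -- (u , v , w): inputs u v, output w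
    purifyGates : List (Fin n × Fin n × Fin n)          -- (u , v , w): input u, outputs v w
    oracleGates : List (Vec (Fin n) N × Fin n)          -- (u₁..u_N , v): inputs u, output v

open Instance public

triple : {A : Set} → A × A × A → List A
triple (u , v , w) = u ∷ v ∷ w ∷ []

oracleNodes : {n N : ℕ} → Vec (Fin n) N × Fin n → List (Fin n)
oracleNodes (us , v) = toList us ++ (v ∷ [])

outputs : {n N : ℕ} → Instance n N → List (Fin n)
outputs I =
     concatMap (λ { (u , v , w) → w ∷ [] }) (norGates I)
  ++ concatMap (λ { (u , v , w) → v ∷ w ∷ [] }) (purifyGates I)
  ++ concatMap (λ { (us , v) → v ∷ [] }) (oracleGates I)

WellFormed : {n N : ℕ} → Instance n N → Set
WellFormed {n} I =
    All (λ g → Unique (triple g)) (norGates I)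
  × All (λ g → Unique (triple g)) (purifyGates I)
  × All (λ g → Unique (oracleNodes g)) (oracleGates I)
  × Unique (outputs I)
  × ((x : Fin n) → x ∈ outputs I)

Oracle : ℕ → Set
Oracle N = Vec Bool N → Bool

Assignment : ℕ → Set
Assignment n = Fin n → Val

mapV : {n N : ℕ} → (Fin n → Val) → Vec (Fin n) N → Vec Val N
mapV b us = Data.Vec.map b us

NorOK : {n : ℕ} → Assignment n → Fin n × Fin n × Fin n → Set
NorOK b (u , v , w) =
    (b u ≡ v0 → b v ≡ v0 → b w ≡ v1)
  × ((b u ≡ v1 Data.Sum.⊎ b v ≡ v1) → b w ≡ v0)
  where import Data.Sum

PurifyOK : {n : ℕ} → Assignment n → Fin n × Fin n × Fin n → Set
PurifyOK b (u , v , w) =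
    (IsBit (b v) Data.Sum.⊎ IsBit (b w))
  × ((x : Bool) → b u ≡ bit x → (b v ≡ bit x × b w ≡ bit x))
  where import Data.Sum

OracleOK : {n N : ℕ} → Oracle N → Assignment n → Vec (Fin n) N × Fin n → Set
OracleOK {n} {N} L b (us , v) =
  (xs : Vec Bool N) → mapV b us ≡ Data.Vec.map bit xs → b v ≡ bit (L xs)

IsSolution : {n N : ℕ} → Instance n N → Oracle N → Assignment n → Set
IsSolution I L b =
    All (NorOK b) (norGates I)
  × All (PurifyOK b) (purifyGates I)
  × All (OracleOK L b) (oracleGates I)

-- Deterministic query algorithms (adaptive decision trees) with black-box
-- access to L : {0,1}^N → {0,1}, outputting a value of type A.
data QueryAlg (N : ℕ) (A : Set) : Set where
  output : A → QueryAlg N A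
  query  : Vec Bool N → (ifFalse ifTrue : QueryAlg N A) → QueryAlg N A

run : {N : ℕ} {A : Set} → QueryAlg N A → Oracle N → A
run (output a) L = a
run (query x t f) L with L x
... | false = run t L
... | true  = run f L

queries : {N : ℕ} {A : Set} → QueryAlg N A → Oracle N → ℕ
queries (output a) L = 0
queries (query x t f) L with L x
... | false = suc (queries t L)
... | true  = suc (queries f L)

Solves : {n N : ℕ} → Instance n N → QueryAlg N (Assignment n) → Set
Solves I A = (L : Oracle _) → IsSolution I L (run A L)

-- A path from the origin to end in {0,1}^r is hidden in the oracle. Points have coordinates in {0,…,5}, and their
-- sign labels drive (a , b) along (v , v) → (v , S v) → (S v , S v) → … on the level ξ = 0, backwards on the levels
-- ξ = 1, 2, and towards the origin above. Hence a cluster of neighbouring points with no uniformly pushed coordinate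
-- must contain a point whose label consults S or P at end. The circuit purifies each of the D = 2 + 2 r coordinates
-- into five bits, at most one of them impure, and makes (D + 1)² copies of each bit; all but D copies are pure, and
-- they form such a cluster. Every oracle input that is pure must have been queried, so a correct algorithm touches
-- end; but an adversary that extends the path by a fresh vertex whenever end is touched survives 2^r queries.
-- The circuit has O(D · D²) = O(r³) nodes.
module Submission where

open import Defs
open import Data.Nat using (ℕ; zero; suc; _≤_; _∸_; z≤n; s≤s; _≤?_; _+_; _*_; _^_; _<_; _<?_) renaming (_≟_ to _≟ⁿ_)
open import Data.Nat.Properties using (≤-trans; ≰⇒>; ≤-pred; pred-mono-≤; ∸-monoʳ-≤; pred[m∸n]≡m∸[1+n]; ≤-reflexive; <⇒≱; ≮⇒≥; m≤m+n; +-suc; +-mono-≤; +-identityʳ; n<1+n; +-assoc; m≤m*n; m∸n+n≡m; ≤∧≢⇒<; ^-monoʳ-≤; m≤n⇒m≤1+n)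
open import Data.Bool using (Bool; true; false; not; if_then_else_)
open import Data.Bool.Properties using (¬-not; not-¬) renaming (_≟_ to _≟ᵇ_)
open import Data.Fin using (Fin; zero; suc; inject₁; fromℕ; combine; remQuot; _↑ˡ_; _↑ʳ_; splitAt)
open import Data.Fin.Properties using (all?; injective⇒≤; suc-injective; _≟_; any?; <⇒≢; pigeonhole; remQuot-combine; +↔⊎; *↔×; 2↔Bool; splitAt-↑ˡ; splitAt-↑ʳ)
open import Data.Vec as Vec using (Vec; tabulate; lookup; replicate; []; _∷_; toList)
open import Data.Vec.Properties using (≡-dec; tabulate-cong; tabulate∘lookup; lookup∘tabulate; lookup-replicate; tabulate-∘)
open import Data.Product using (_×_; _,_; proj₁; proj₂; ∃; ∃-syntax; Σ-syntax; Σ)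
open import Data.Sum as Sum using (_⊎_; inj₁; inj₂; fromInj₂)
open import Data.Empty using (⊥; ⊥-elim)
open import Function using (_∘_)
open import Relation.Nullary using (¬_; Dec; yes; no; does; ¬?; _×-dec_; _⊎-dec_)
open import Relation.Nullary.Decidable using (dec-true; dec-false; decidable-stable)
open import Relation.Binary.PropositionalEquality
open import Data.List as List using (List; []; _∷_; length; _++_; concatMap)
open import Data.List.Membership.Propositional using (_∈_; _∉_)
open import Data.List.Relation.Unary.Any using (here; there)
open import Data.List.Membership.Propositional.Properties using (∈-++⁺ˡ; ∈-++⁺ʳ; ∈-++⁻; ∈-tabulate⁻)
open import Data.List.Relation.Unary.All using ([]; _∷_)
open import Data.List.Relation.Unary.All.Properties using (tabulate⁺; tabulate⁻)
open import Data.List.Relation.Unary.AllPairs using ([]; _∷_)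
open import Data.List.Relation.Unary.Unique.Propositional using (Unique)
open import Data.List.Relation.Unary.Unique.Propositional.Properties using (++⁺) renaming (tabulate⁺ to unique-tabulate)
open import Function.Bundles using (_↔_; Inverse; mk↔ₛ′)
open import Data.Nat.Tactic.RingSolver using (solve-∀)
open import Data.Product.Function.NonDependent.Propositional using (_×-↔_)
open import Data.Sum.Function.Propositional using (_⊎-↔_)
open import Function.Properties.Inverse using (↔-sym; ↔-trans; ↔-refl)

-- The thresholds are staggered so that a cluster, whose points differ by at most 1 in each
-- coordinate, meets one change of rule at a time. Along ξ the flow reverses between 0 and 1, the
-- lift inside a tube turns from down to up between 1 and 2, and the pull towards the origin sets in
-- between 2 and 3. So inside a tube ξ is uniformly pushed on levels 0 and 1, while on levels 1 and
-- 2 the flow is uniformly backward. The backward levels are needed because at the origin a forward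
-- flow on level 2 would oppose the pull towards the origin on level 3. Along φ the phases meet
-- between 2 and 3, but a tube lets its mover roam only for ψ ≤ 1, so tube points next to the
-- meeting have a and b at corners. All this fits into the values 0 to 5, hence five bits: a
-- coordinate is the number of ones among its bits, and a single impure bit shifts it by at most 1.

private variable r N : ℕ

-- The labelled point set

ext : Bool → ℕ
ext false = 0
ext true  = 5

hi : ℕ → Bool
hi (suc (suc (suc _))) = true
hi _                   = false

Near : ℕ → ℕ → Set
Near k l = k ≤ suc l × l ≤ suc k

hi-ext : ∀ c → hi (ext c) ≡ c
hi-ext false = refl
hi-ext true  = refl

near-ext : ∀ c {k l} → k ≡ ext c → Near k l → hi l ≡ c
near-ext false refl (_ , z≤n)     = refl
near-ext false refl (_ , s≤s z≤n) = refl
near-ext true  refl (s≤s (s≤s (s≤s (s≤s _))) , _) = refl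

hi⇒3≤ : ∀ {k} → hi k ≡ true → 3 ≤ k
hi⇒3≤ {suc (suc (suc k))} _ = s≤s (s≤s (s≤s z≤n))

lo⇒≤2 : ∀ {k} → hi k ≡ false → k ≤ 2
lo⇒≤2 {0} _ = z≤n
lo⇒≤2 {1} _ = s≤s z≤n
lo⇒≤2 {2} _ = s≤s (s≤s z≤n)

abstract
  _≟ᵛ_ : (v w : Vec Bool r) → Dec (v ≡ w)
  _≟ᵛ_ = ≡-dec _≟ᵇ_

origin : Vec Bool r
origin = replicate _ false

round : (Fin r → ℕ) → Vec Bool r
round p = tabulate (hi ∘ p)

At : (Fin r → ℕ) → Vec Bool r → Set
At p v = ∀ j → p j ≡ ext (lookup v j)

abstract
  At? : (p : Fin r → ℕ) (v : Vec Bool r) → Dec (At p v)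
  At? p v = all? λ j → p j ≟ⁿ ext (lookup v j)

-- From 0 or 5 a step of 1 does not reach the rounding threshold. So one member of a cluster exactly
-- at a corner lets every member recognise that corner.
near-round : ∀ {p q : Fin r → ℕ} {v} → At p v → (∀ j → Near (p j) (q j)) → round q ≡ v
near-round {v = v} at near =
  trans (tabulate-cong λ j → near-ext (lookup v j) (at j) (near j)) (tabulate∘lookup v)

at-round : ∀ {p : Fin r → ℕ} {v} → At p v → round p ≡ v
at-round {v = v} at =
  trans (tabulate-cong λ j → trans (cong hi (at j)) (hi-ext (lookup v j))) (tabulate∘lookup v)

1≰0 : ¬ (1 ≤ 0)
1≰0 ()

at-unique : ∀ {p : Fin r → ℕ} {v w} → At p v → At p w → v ≡ w
at-unique at at′ = trans (sym (at-round at)) (at-round at′)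

cases : ∀ {Z : Set} c → (c ≡ true → Z) → (c ≡ false → Z) → Z
cases true  t f = t refl
cases false t f = f refl

-- a and b hold two vertices of the hidden path, φ says which of the two is being replaced, and ξ is the lift off
-- the path. A label true (false) pushes its coordinate up (down).
data Coord (r : ℕ) : Set where
  φ ξ : Coord r
  a b : Fin r → Coord r

Point : ℕ → Set
Point r = Coord r → ℕ

-- ψ is the distance travelled in the current phase: the anchored vertex rests at home while the mover travels
-- between src and dst, from src to dst for ξ = 0 and back for ξ ≥ 1; back = false forbids leaving the origin backwards.
Exit : (mover : Fin r → ℕ) (src dst : Vec Bool r) (back : Bool) → ℕ → Set
Exit mover src dst back zero    = At mover dst
Exit mover src dst back (suc _) = At mover src × back ≡ true

abstract
  exit? : ∀ (mover : Fin r → ℕ) src dst back ξ → Dec (Exit mover src dst back ξ)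
  exit? mover src dst back zero    = At? mover dst
  exit? mover src dst back (suc _) = At? mover src ×-dec (back ≟ᵇ true)

-- For positive ψ a mover that rounds to an endpoint is held there, so `from` is left only at ψ = 0,
-- far from the meeting of the phases.
aim : ℕ → (from to current : Vec Bool r) → Vec Bool r
aim zero    from to current = to
aim (suc _) from to current = if does (current ≟ᵛ from) then from else to

target : (ψ ξ : ℕ) (src dst current : Vec Bool r) → Vec Bool r
target ψ zero    src dst current = aim ψ src dst current
target ψ (suc _) src dst current = aim ψ dst src current

-- Beyond ψ = 1 the tube narrows to the two corners where another phase is entered: `dst` for the
-- forward flow, `src` for the backward one.
Inside : (ψ : ℕ) (mover : Fin r → ℕ) (src dst : Vec Bool r) (back : Bool) → Set
Inside ψ mover src dst back =
  ψ ≤ 1 ⊎ Exit mover src dst back 0 ⊎ Exit mover src dst back 1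

abstract
  inside? : ∀ ψ (mover : Fin r → ℕ) src dst back → Dec (Inside ψ mover src dst back)
  inside? ψ mover src dst back =
    (ψ ≤? 1) ⊎-dec (exit? mover src dst back 0 ⊎-dec exit? mover src dst back 1)

-- The condition `src ≢ dst` cuts the tube at a missing edge, so that ξ is pushed up there on levels
-- 0 and 1.
Tube : (ψ : ℕ) (anchor mover : Fin r → ℕ) (home src dst : Vec Bool r) (back : Bool) → Set
Tube ψ anchor mover home src dst back =
  src ≢ dst × At anchor home × Inside ψ mover src dst back

abstract
  tube? : ∀ ψ (anchor mover : Fin r → ℕ) home src dst back → Dec (Tube ψ anchor mover home src dst back)
  tube? ψ anchor mover home src dst back =
    ¬? (src ≟ᵛ dst) ×-dec (At? anchor home ×-dec inside? ψ mover src dst back)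

AtOrigin : Point r → Set
AtOrigin x = x φ ≡ 0 × At (x ∘ a) origin × At (x ∘ b) origin

abstract
  atOrigin? : (x : Point r) → Dec (AtOrigin x)
  atOrigin? x = (x φ ≟ⁿ 0) ×-dec (At? (x ∘ a) origin ×-dec At? (x ∘ b) origin)

-- From level 2 on, the exact origin is the only place of descent; this is how the flow from above
-- is fed into the start of the path.
leave : ℕ → Bool → Bool → Bool
leave zero          tube org = not tube
leave (suc zero)    tube org = not tube
leave (suc (suc _)) tube org = not org

-- For φ ≤ 2 the anchor is a = v and b travels from v to S v; for φ ≥ 3 it is b = w and a travels from P w to w,
-- with ψ = 5 ∸ φ.
lowTube highTube : Point r → (v w : Vec Bool r) → Set
lowTube  x v w = Tube (x φ) (x ∘ a) (x ∘ b) v v w (not (does (v ≟ᵛ origin)))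
highTube x v w = Tube (5 ∸ x φ) (x ∘ b) (x ∘ a) w v w true

lowTube? : ∀ (x : Point r) v w → Dec (lowTube x v w)
lowTube?  x v w = tube? _ _ _ v _ _ _

highTube? : ∀ (x : Point r) v w → Dec (highTube x v w)
highTube? x v w = tube? _ _ _ w _ _ _

lowLabel highLabel : Point r → (v w : Vec Bool r) → Coord r → Bool
lowLabel x v w φ     = does (exit? (x ∘ b) v w (not (does (v ≟ᵛ origin))) (x ξ))
lowLabel x v w ξ     = leave (x ξ) (does (lowTube? x v w)) (does (atOrigin? x))
lowLabel x v w (a j) = lookup v j
lowLabel x v w (b j) = lookup (target (x φ) (x ξ) v w (round (x ∘ b))) j
highLabel x v w φ     = not (does (exit? (x ∘ a) v w true (x ξ)))
highLabel x v w ξ     = leave (x ξ) (does (highTube? x v w)) (does (atOrigin? x))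
highLabel x v w (a j) = lookup (target (5 ∸ x φ) (x ξ) v w (round (x ∘ a))) j
highLabel x v w (b j) = lookup w j

offLabel : Point r → Coord r → Bool
offLabel x ξ = not (does (atOrigin? x))
offLabel x _ = false

-- The only vertex at which S or P is consulted to compute a label.
touch : Point r → Vec Bool r
touch x = if hi (x φ) then round (x ∘ b) else round (x ∘ a)

label : (S P : Vec Bool r → Vec Bool r) → Point r → Coord r → Bool
label S P x c =
  if hi (x ξ) then offLabel x c else
  if hi (x φ) then highLabel x (P (round (x ∘ b))) (round (x ∘ b)) c
              else lowLabel x (round (x ∘ a)) (S (round (x ∘ a))) c

label-cong : ∀ {S S′ P P′ : Vec Bool r → Vec Bool r} x c →
  S (touch x) ≡ S′ (touch x) → P (touch x) ≡ P′ (touch x) → label S P x c ≡ label S′ P′ x c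
label-cong x c s p with hi (x ξ) | hi (x φ)
... | true  | _     = refl
... | false | true  rewrite p = refl
... | false | false rewrite s = refl

-- Fixed points of S and P encode missing edges.
record Path (S P : Vec Bool r → Vec Bool r) (end : Vec Bool r) : Set where
  field
    P∘S      : ∀ v → S v ≢ v → P (S v) ≡ v
    S∘P      : ∀ v → P v ≢ v → S (P v) ≡ v
    P-origin : P origin ≡ origin
    has-S    : ∀ v → v ≢ end → v ≡ origin ⊎ P v ≢ v → S v ≢ v
    has-P    : ∀ v → v ≢ origin → S v ≢ v → P v ≢ v

-- Clusters within one phase

aim-to : ∀ ψ {from to current : Vec Bool r} → current ≡ to → aim ψ from to current ≡ to
aim-to zero eq = refl
aim-to (suc _) {from} {to} refl with to ≟ᵛ from
... | yes e = sym e
... | no _  = refl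

aim-stay : ∀ {ψ} {from to current : Vec Bool r} → 1 ≤ ψ → current ≡ from ⊎ current ≡ to →
  aim ψ from to current ≡ current
aim-stay {ψ = suc _} {from} {to} {current} _ h with current ≟ᵛ from | h
... | yes e | _      = sym e
... | no ne | inj₁ e = ⊥-elim (ne e)
... | no ne | inj₂ e = sym e

target-stay : ∀ {ψ} k {src dst current : Vec Bool r} → 1 ≤ ψ → current ≡ src ⊎ current ≡ dst →
  target ψ k src dst current ≡ current
target-stay zero    1≤ψ h        = aim-stay 1≤ψ h
target-stay (suc _) 1≤ψ (inj₁ e) = aim-stay 1≤ψ (inj₂ e)
target-stay (suc _) 1≤ψ (inj₂ e) = aim-stay 1≤ψ (inj₁ e)

-- Serves both phases, with ψ = φ or ψ = 5 ∸ φ, and k = ξ. `ψ-exit` reflects that unanimous exits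
-- push ψ to 5, outside the phase; `org` concerns the one tube without a backward exit, at the
-- origin.
module Phase {X : Set} (x₀ : X) (ψ k : X → ℕ) (mover : X → Fin r → ℕ)
  (src dst : Vec Bool r) (back : Bool) (Org : X → Set)
  (ψ-near     : ∀ x y → 2 ≤ ψ x → 1 ≤ ψ y)
  (k-near     : ∀ x y → 2 ≤ k x → 1 ≤ k y)
  (mover-near : ∀ x y t → At (mover x) t → round (mover y) ≡ t)
  (ψ-exit     : ¬ (∀ x → Exit (mover x) src dst back (k x)))
  (ψ-stay     : (∀ x → ¬ Exit (mover x) src dst back (k x)) → ∀ x → ψ x ≡ 0)
  (mover-sol  : ∀ t → (∀ x → target (ψ x) (k x) src dst (round (mover x)) ≡ t) → ∀ x → At (mover x) t)
  (k-sol      : (∀ x → (k x ≤ 1 → Inside (ψ x) (mover x) src dst back) × (2 ≤ k x → Org x)) → ∀ x → k x ≡ 0)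
  (org        : ∀ x → ψ x ≡ 0 → At (mover x) src → back ≡ false → Org x)
  where

  -- If one mover is at `dst`, all round to it, so all are driven exactly there and exit, against
  -- `ψ-exit`. If none is, `ψ-stay` makes ψ zero, where every mover is sent to `dst`.
  forward : ¬ (∀ x → k x ≡ 0)
  forward k≡0 = never x₀ (all-dst (λ x → fwd x (cong (λ n → aim n _ _ _) (ψ≡0 x))) x₀)
    where
    fwd : ∀ x → aim (ψ x) src dst (round (mover x)) ≡ dst →
      target (ψ x) (k x) src dst (round (mover x)) ≡ dst
    fwd x e rewrite k≡0 x = e
    all-dst = mover-sol dst
    never : ∀ x → ¬ At (mover x) dst
    never z at = ψ-exit λ x → subst (Exit (mover x) src dst back) (sym (k≡0 x))
      (all-dst (λ y → fwd y (aim-to (ψ y) (mover-near z y dst at))) x)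
    ψ≡0 : ∀ x → ψ x ≡ 0
    ψ≡0 = ψ-stay λ x e → never x (subst (Exit (mover x) src dst back) (k≡0 x) e)

  exit-back : ∀ {x} → 1 ≤ k x → Exit (mover x) src dst back (k x) → Exit (mover x) src dst back 1
  exit-back {x} 1≤k e with suc _ ← k x = e

  back-exit : ∀ {x} → 1 ≤ k x → Exit (mover x) src dst back 1 → Exit (mover x) src dst back (k x)
  back-exit {x} 1≤k e with suc _ ← k x = e

  module Backward (1≤k : ∀ x → 1 ≤ k x) where
    bwd : ∀ x → aim (ψ x) dst src (round (mover x)) ≡ src →
      target (ψ x) (k x) src dst (round (mover x)) ≡ src
    bwd x e with suc _ ← k x | _ ← 1≤k x = e
    never : ∀ x → ¬ Exit (mover x) src dst back 1
    never z (at , ok) = ψ-exit λ x → back-exit (1≤k x)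
      (mover-sol src (λ y → bwd y (aim-to (ψ y) (mover-near z y src at))) x , ok)
    ψ≡0 : ∀ x → ψ x ≡ 0
    ψ≡0 = ψ-stay λ x e → never x (exit-back (1≤k x) e)
    at-src = mover-sol src λ x → bwd x (cong (λ n → aim n _ _ _) (ψ≡0 x))

  -- The argument of `forward` with `src` and `dst` exchanged. If the backward exit is barred, the
  -- movers come to rest at `src` with ψ = 0; by `org` this is the origin, and there `k-sol` pulls k
  -- down to 0.
  backward : ¬ (∀ x → 1 ≤ k x)
  backward 1≤k with back ≟ᵇ true
  ... | yes ok = never x₀ (at-src x₀ , ok)
    where open Backward 1≤k
  ... | no ¬ok = 1≰0 (subst (1 ≤_) (k-sol inside-or-org x₀) (1≤k x₀))
    where
    open Backward 1≤k
    inside-or-org : ∀ x → (k x ≤ 1 → Inside (ψ x) (mover x) src dst back) × (2 ≤ k x → Org x)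
    inside-or-org x = (λ _ → inj₁ (≤-trans (≤-reflexive (ψ≡0 x)) z≤n)) , λ _ → org x (ψ≡0 x) (at-src x) (¬-not ¬ok)

  -- A member outside has ψ ≥ 2, so every ψ is at least 1 and movers that round to an endpoint are
  -- held there. One exit would then put all movers at that endpoint, including the one outside;
  -- without exits ψ falls to 0.
  outside : ∀ x → ¬ ¬ Inside (ψ x) (mover x) src dst back
  outside y ¬in = ¬in (inj₁ (≤-trans (≤-reflexive (ψ-stay never y)) z≤n))
    where
    1≤ψ : ∀ x → 1 ≤ ψ x
    1≤ψ x = ψ-near y x (≰⇒> (¬in ∘ inj₁))
    at-all : ∀ z t → t ≡ src ⊎ t ≡ dst → At (mover z) t → ∀ x → At (mover x) t
    at-all z t t∈ at = mover-sol t λ x →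
      let e = mover-near z x t at in
      trans (target-stay (k x) (1≤ψ x) (Sum.map (trans e) (trans e) t∈)) e
    never : ∀ x → ¬ Exit (mover x) src dst back (k x)
    never z e with k z
    ... | zero  = ¬in (inj₂ (inj₁ (at-all z dst (inj₂ refl) e y)))
    ... | suc _ = ¬in (inj₂ (inj₂ (at-all z src (inj₁ refl) (proj₁ e) y , proj₂ e)))

  impossible : ⊥
  impossible = forward (k-sol λ x →
    (λ _ → decidable-stable (inside? _ _ src dst back) (outside x)) ,
    -- A member on level 2 leaves no member on level 0, so the whole cluster flows backward.
    (λ 2≤k → ⊥-elim (backward λ y → k-near x y 2≤k)))

leave-above : ∀ {k t o} → 2 ≤ k → leave k t o ≡ not o
leave-above (s≤s (s≤s _)) = refl

leave-false : ∀ k {A B : Set} (a? : Dec A) (b? : Dec B) → (k ≤ 1 → A) × (2 ≤ k → B) →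
  leave k (does a?) (does b?) ≡ false
leave-false zero          a? b? (h , _) = cong not (dec-true a? (h z≤n))
leave-false (suc zero)    a? b? (h , _) = cong not (dec-true a? (h (s≤s z≤n)))
leave-false (suc (suc k)) a? b? (_ , h) = cong not (dec-true b? (h (s≤s (s≤s z≤n))))

leave-true : ∀ k {A B : Set} (a? : Dec A) (b? : Dec B) → ¬ A → ¬ B → leave k (does a?) (does b?) ≡ true
leave-true zero          a? b? ¬a ¬b = cong not (dec-false a? ¬a)
leave-true (suc zero)    a? b? ¬a ¬b = cong not (dec-false a? ¬a)
leave-true (suc (suc k)) a? b? ¬a ¬b = cong not (dec-false b? ¬b)

module _ (S P : Vec Bool r → Vec Bool r) where

  off-label : ∀ x c → hi (x ξ) ≡ true → label S P x c ≡ offLabel x c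
  off-label x c e rewrite e = refl

  low-label : ∀ x c {v} → hi (x ξ) ≡ false → hi (x φ) ≡ false → round (x ∘ a) ≡ v →
    label S P x c ≡ lowLabel x v (S v) c
  low-label x c e e′ refl rewrite e | e′ = refl

  high-label : ∀ x c {w} → hi (x ξ) ≡ false → hi (x φ) ≡ true → round (x ∘ b) ≡ w →
    label S P x c ≡ highLabel x (P w) w c
  high-label x c e e′ refl rewrite e | e′ = refl

  lift-label : ∀ x → 2 ≤ x ξ → label S P x ξ ≡ not (does (atOrigin? x))
  lift-label x 2≤ with hi (x ξ) | hi (x φ)
  ... | true  | _     = refl
  ... | false | true  = leave-above 2≤
  ... | false | false = leave-above 2≤

  touch-low : ∀ (x : Point r) → hi (x φ) ≡ false → touch x ≡ round (x ∘ a)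
  touch-low x e rewrite e = refl

1≤2 : 1 ≤ 2
1≤2 = s≤s z≤n

-- Since sol has only universally quantified premises and the goal is ⊥, X needs no decidability.
module Cluster {S P : Vec Bool r → Vec Bool r} {end : Vec Bool r} (path : Path S P end)
  {X : Set} (x₀ : X) (pt : X → Point r)
  (near  : ∀ x y c → Near (pt x c) (pt y c))
  (sol   : ∀ c s → (∀ x → label S P (pt x) c ≡ s) → ∀ x → pt x c ≡ ext s)
  (avoid : ∀ x → touch (pt x) ≢ end)
  where
  open Path path

  A B : X → Fin r → ℕ
  A x = pt x ∘ a
  B x = pt x ∘ b

  near-round-a : ∀ x y v → At (A x) v → round (A y) ≡ v
  near-round-a x y v at = near-round {v = v} at λ j → near x y (a j)

  near-round-b : ∀ x y v → At (B x) v → round (B y) ≡ v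
  near-round-b x y v at = near-round {v = v} at λ j → near x y (b j)

  module AboveTwo (2≤ξ : ∀ x → 2 ≤ pt x ξ) where

    no-zero : ¬ (∀ x → pt x ξ ≡ 0)
    no-zero e with pt x₀ ξ | 2≤ξ x₀ | e x₀
    ... | _ | () | refl

    -- Near the origin level 2 has no backward exit and sends a and b to the origin, as the levels
    -- above do. So φ, a and b are unanimously pushed to 0, the whole cluster sits at the origin,
    -- and ξ is pushed down everywhere.
    not-at-origin : ∀ z → ¬ AtOrigin (pt z)
    not-at-origin z (φ≡0 , at-a , at-b) = no-zero (sol ξ false λ x →
      trans (lift-label S P (pt x) (2≤ξ x)) (cong not (dec-true (atOrigin? (pt x)) (φ-zero x , a-origin x , b-origin x))))
      where
      lo : ∀ x → hi (pt x φ) ≡ false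
      lo x = near-ext false φ≡0 (near z x φ)
      round-a : ∀ x → round (A x) ≡ origin
      round-a x = near-round-a z x origin at-a
      zero-lookup : ∀ j → lookup (origin {r}) j ≡ false
      zero-lookup j = lookup-replicate j false
      low : ∀ c x → hi (pt x ξ) ≡ false → label S P (pt x) c ≡ lowLabel (pt x) origin (S origin) c
      low c x e = low-label S P (pt x) c e (lo x) (round-a x)
      not-back : not (does (origin {r} ≟ᵛ origin)) ≡ false
      not-back = cong not (dec-true (origin ≟ᵛ origin) refl)
      no-exit : ∀ {mover : Fin r → ℕ} {dst} {back} k → 2 ≤ k → back ≡ false →
        does (exit? mover origin dst back k) ≡ false
      no-exit (suc k) _ refl = dec-false (exit? _ _ _ false (suc k)) λ ()
      back-target : ∀ ψ k {dst current : Vec Bool r} → 2 ≤ k → current ≡ origin → target ψ k origin dst current ≡ origin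
      back-target ψ (suc k) _ = aim-to ψ
      φ-label : ∀ x → label S P (pt x) φ ≡ false
      φ-label x = cases (hi (pt x ξ))
        (λ e → off-label S P (pt x) φ e)
        (λ e → trans (low φ x e) (no-exit (pt x ξ) (2≤ξ x) not-back))
      φ-zero : ∀ x → pt x φ ≡ 0
      φ-zero = sol φ false φ-label
      a-label : ∀ j x → label S P (pt x) (a j) ≡ lookup (origin {r}) j
      a-label j x = cases (hi (pt x ξ))
        (λ e → trans (off-label S P (pt x) (a j) e) (sym (zero-lookup j)))
        (λ e → low (a j) x e)
      a-origin : ∀ x → At (A x) origin
      a-origin x j = sol (a j) _ (a-label j) x
      b-label : ∀ j x → label S P (pt x) (b j) ≡ lookup (origin {r}) j
      b-label j x = cases (hi (pt x ξ))
        (λ e → trans (off-label S P (pt x) (b j) e) (sym (zero-lookup j)))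
        (λ e → trans (low (b j) x e) (cong (λ v → lookup v j)
        (back-target (pt x φ) (pt x ξ) (2≤ξ x) (near-round-b z x origin at-b))))
      b-origin : ∀ x → At (B x) origin
      b-origin x j = sol (b j) _ (b-label j) x

    impossible : ⊥
    -- With no member at the origin ξ rises to 5 everywhere, and there `offLabel` drives all other
    -- coordinates to the origin.
    impossible = not-at-origin x₀
      ( all-false φ refl x₀
      , (λ j → trans (all-false (a j) refl x₀) (cong ext (sym (lookup-replicate j false))))
      , (λ j → trans (all-false (b j) refl x₀) (cong ext (sym (lookup-replicate j false)))) )
      where
      top : ∀ x → pt x ξ ≡ 5
      top = sol ξ true λ x → trans (lift-label S P (pt x) (2≤ξ x)) (cong not (dec-false (atOrigin? (pt x)) (not-at-origin x)))
      all-false : ∀ c → (∀ {x} → offLabel x c ≡ false) → ∀ x → pt x c ≡ 0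
      all-false c e = sol c false λ x → trans (off-label S P (pt x) c (cong hi (top x))) e

  3≤⇒2≤ : ∀ {k l} → 3 ≤ k → Near k l → 2 ≤ l
  3≤⇒2≤ 3≤k (k≤1+l , _) = ≤-pred (≤-trans 3≤k k≤1+l)

  ξ-lo : ∀ x → hi (pt x ξ) ≡ false
  ξ-lo x = ¬-not λ e → AboveTwo.impossible λ y → 3≤⇒2≤ (hi⇒3≤ e) (near x y ξ)

  low : ∀ c x {v} → hi (pt x φ) ≡ false → round (A x) ≡ v → label S P (pt x) c ≡ lowLabel (pt x) v (S v) c
  low c x = low-label S P (pt x) c (ξ-lo x)

  high : ∀ c x {w} → hi (pt x φ) ≡ true → round (B x) ≡ w → label S P (pt x) c ≡ highLabel (pt x) (P w) w c
  high c x = high-label S P (pt x) c (ξ-lo x)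

  contra : ∀ {c : Bool} {Z : Set} → c ≡ true → c ≡ false → Z
  contra refl ()

  k-near : ∀ x y → 2 ≤ pt x ξ → 1 ≤ pt y ξ
  k-near x y 2≤ = ≤-pred (≤-trans 2≤ (proj₁ (near x y ξ)))

  -- The push on φ where the phases meet: on level 0 up at a `crossing` corner and down at a
  -- `staying` one, reversed on the backward levels.
  directed : Bool → ℕ → Bool
  directed f zero    = f
  directed f (suc _) = not f

  -- The corners (v , S v) and (v , v) through which the path changes phase. At the second, one
  -- phase holds the edge into v and the other the edge out of v, so both edges must exist.
  data Crossing (α β : Vec Bool r) : Set where
    crossing : S α ≡ β → P β ≡ α → α ≢ β → Crossing α β
    staying  : α ≡ β → α ≢ origin → S α ≢ α → P α ≢ α → Crossing α β

  crossed : ∀ {α β} → Crossing α β → Bool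
  crossed (crossing _ _ _)  = true
  crossed (staying _ _ _ _) = false

  low-exit : ∀ {α β} (cr : Crossing α β) {q} → At q β → ∀ k →
    does (exit? q α (S α) (not (does (α ≟ᵛ origin))) k) ≡ directed (crossed cr) k
  low-exit (crossing refl p ne) at zero    = dec-true (exit? _ _ _ _ 0) at
  low-exit {α} (crossing refl p ne) at (suc k) = dec-false (exit? _ α (S α) _ (suc k)) λ e → ne (at-unique (proj₁ e) at)
  low-exit {α} (staying refl ≢0 S≢ P≢) at zero    = dec-false (exit? _ α (S α) _ 0) λ at′ → S≢ (at-unique at′ at)
  low-exit {α} (staying refl ≢0 S≢ P≢) at (suc k) =
    dec-true (exit? _ α (S α) _ (suc k)) (at , cong not (dec-false (α ≟ᵛ origin) ≢0))

  high-exit : ∀ {α β} (cr : Crossing α β) {p} → At p α → ∀ k →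
    not (does (exit? p (P β) β true k)) ≡ directed (crossed cr) k
  high-exit {β = β} (crossing _ refl ne) at zero    = cong not (dec-false (exit? _ (P β) β true 0) λ at′ → ne (at-unique at at′))
  high-exit {β = β} (crossing _ refl ne) at (suc k) = cong not (dec-true (exit? _ (P β) β true (suc k)) (at , refl))
  high-exit {β = β} (staying refl ≢0 S≢ P≢) at zero    = cong not (dec-true (exit? _ (P β) β true 0) at)
  high-exit {β = β} (staying refl ≢0 S≢ P≢) at (suc k) =
    cong not (dec-false (exit? _ (P β) β true (suc k)) λ e → P≢ (at-unique (proj₁ e) at))

  in-low : ∀ {α β} → Crossing α β → ∀ x → At (x ∘ a) α → At (x ∘ b) β → lowTube x α (S α)
  in-low (crossing refl p ne) x at-a at-b = ne , at-a , inj₂ (inj₁ at-b)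
  in-low {α} (staying refl ≢0 S≢ P≢) x at-a at-b =
    S≢ ∘ sym , at-a , inj₂ (inj₂ (at-b , cong not (dec-false (α ≟ᵛ origin) ≢0)))

  in-high : ∀ {α β} → Crossing α β → ∀ x → At (x ∘ a) α → At (x ∘ b) β → highTube x (P β) β
  in-high (crossing _ refl ne) x at-a at-b = ne , at-b , inj₂ (inj₂ (at-a , refl))
  in-high (staying refl ≢0 S≢ P≢) x at-a at-b = P≢ , at-b , inj₂ (inj₁ at-a)

  -- Here φ is 2 or 3 throughout, so its labels cannot be unanimous. Yet at a crossing corner they
  -- are: a member on level 2 leaves only backward levels, and otherwise the tube pushes ξ to 0,
  -- where the flow is forward.
  module Mixed (α β : Vec Bool r) (round-a : ∀ x → round (A x) ≡ α) (round-b : ∀ x → round (B x) ≡ β)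
    (l h : X) (l-lo : hi (pt l φ) ≡ false) (h-hi : hi (pt h φ) ≡ true) where

    2≤φ : ∀ x → 2 ≤ pt x φ
    2≤φ x = 3≤⇒2≤ (hi⇒3≤ h-hi) (near h x φ)

    φ≤3 : ∀ x → pt x φ ≤ 3
    φ≤3 x = ≤-trans (proj₂ (near l x φ)) (s≤s (lo⇒≤2 l-lo))

    1≤φ : ∀ x → 1 ≤ pt x φ
    1≤φ x = ≤-trans 1≤2 (2≤φ x)

    1≤ψ : ∀ x → 1 ≤ 5 ∸ pt x φ
    1≤ψ x = ≤-trans 1≤2 (∸-monoʳ-≤ 5 (φ≤3 x))

    src-or-dst : Crossing α β → (β ≡ α ⊎ β ≡ S α) × (α ≡ P β ⊎ α ≡ β)
    src-or-dst (crossing s p _)  = inj₂ (sym s) , inj₁ (sym p)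
    src-or-dst (staying e _ _ _) = inj₁ (sym e) , inj₂ e

    module _ (cr : Crossing α β) where
      at-a : ∀ x → At (A x) α
      at-a x j = sol (a j) (lookup α j) lab x
        where
        lab : ∀ y → label S P (pt y) (a j) ≡ lookup α j
        lab y = cases (hi (pt y φ))
          (λ e → trans (high (a j) y e (round-b y)) (cong (λ v → lookup v j)
          (trans (target-stay (pt y ξ) (1≤ψ y) (Sum.map (trans (round-a y)) (trans (round-a y)) (proj₂ (src-or-dst cr)))) (round-a y))))
          (λ e → low (a j) y e (round-a y))

      at-b : ∀ x → At (B x) β
      at-b x j = sol (b j) (lookup β j) lab x
        where
        lab : ∀ y → label S P (pt y) (b j) ≡ lookup β j
        lab y = cases (hi (pt y φ))
          (λ e → high (b j) y e (round-b y))
          (λ e → trans (low (b j) y e (round-a y)) (cong (λ v → lookup v j)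
          (trans (target-stay (pt y ξ) (1≤φ y) (Sum.map (trans (round-b y)) (trans (round-b y)) (proj₁ (src-or-dst cr)))) (round-b y))))

      flow : Bool
      flow = crossed cr

      φ-label : ∀ x → label S P (pt x) φ ≡ directed flow (pt x ξ)
      φ-label x = cases (hi (pt x φ))
        (λ e → trans (high φ x e (round-b x)) (high-exit cr (at-a x) (pt x ξ)))
        (λ e → trans (low φ x e (round-a x)) (low-exit cr (at-b x) (pt x ξ)))

      undirected : ∀ s → ¬ (∀ x → directed flow (pt x ξ) ≡ s)
      undirected s h′ = not-ext s (sol φ s (λ x → trans (φ-label x) (h′ x)) l) (2≤φ l) (φ≤3 l)
        where
        not-ext : ∀ s {k} → k ≡ ext s → 2 ≤ k → k ≤ 3 → ⊥
        not-ext false refl () _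
        not-ext true  refl _ (s≤s (s≤s (s≤s ())))

      backward : ¬ (∀ x → 1 ≤ pt x ξ)
      backward 1≤ξ = undirected (not flow) λ x → bwd (1≤ξ x)
        where
        bwd : ∀ {k} → 1 ≤ k → directed flow k ≡ not flow
        bwd (s≤s _) = refl

      impossible : ⊥
      impossible = undirected flow λ x → cong (directed flow) (sol ξ false lab x)
        where
        no-two : ∀ x → 2 ≤ pt x ξ → AtOrigin (pt x)
        no-two x 2≤ = ⊥-elim (backward λ y → k-near x y 2≤)
        lab : ∀ x → label S P (pt x) ξ ≡ false
        lab x = cases (hi (pt x φ))
          (λ e → trans (high ξ x e (round-b x))
                        (leave-false (pt x ξ) (highTube? (pt x) (P β) β) (atOrigin? (pt x)) ((λ _ → in-high cr (pt x) (at-a x) (at-b x)) , no-two x)))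
          (λ e → trans (low ξ x e (round-a x))
                        (leave-false (pt x ξ) (lowTube? (pt x) α (S α)) (atOrigin? (pt x)) ((λ _ → in-low cr (pt x) (at-a x) (at-b x)) , no-two x)))

  module LowOnly (z : X) (z-lo : hi (pt z φ) ≡ false)
    (tube : lowTube (pt z) (round (A z)) (S (round (A z)))) where

    v : Vec Bool r
    v = round (A z)

    round-a : ∀ x → round (A x) ≡ v
    round-a x = near-round-a z x v (proj₁ (proj₂ tube))

    -- A high neighbour forces φ ≥ 2 at z, which rules out the roaming part of the tube and leaves z
    -- at a corner shared with the other phase.
    mixed : ∀ y → hi (pt y φ) ≡ true → ⊥
    mixed y y-hi with proj₂ (proj₂ tube)
    ... | inj₁ φ≤1 = 2≰1 (≤-trans (3≤⇒2≤ (hi⇒3≤ y-hi) (near y z φ)) φ≤1)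
      where
      2≰1 : ¬ (2 ≤ 1)
      2≰1 (s≤s ())
    ... | inj₂ (inj₁ at) = Mixed.impossible v (S v) round-a (λ x → near-round-b z x (S v) at) z y z-lo y-hi
      (crossing refl (P∘S v (proj₁ tube ∘ sym)) (proj₁ tube))
    ... | inj₂ (inj₂ (at , back)) = Mixed.impossible v v round-a (λ x → near-round-b z x v at) z y z-lo y-hi
      (staying refl ≢0 (proj₁ tube ∘ sym) (has-P v ≢0 (proj₁ tube ∘ sym)))
      where
      ≢0 : v ≢ origin
      ≢0 e = contra (trans (sym (cong not (dec-true (v ≟ᵛ origin) e))) back) refl

    lo : ∀ x → hi (pt x φ) ≡ false
    lo x = ¬-not (mixed x)

    at-a : ∀ x → At (A x) v
    at-a x j = sol (a j) (lookup v j) (λ y → low (a j) y (lo y) (round-a y)) x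

    impossible : ⊥
    impossible = Phase.impossible z (λ x → pt x φ) (λ x → pt x ξ) B v (S v) (not (does (v ≟ᵛ origin)))
      (AtOrigin ∘ pt)
      (λ x y 2≤ → ≤-pred (≤-trans 2≤ (proj₁ (near x y φ))))
      k-near near-round-b
      (λ e → five-not-lo (sol φ true (λ x → trans (low φ x (lo x) (round-a x)) (dec-true (exit? _ _ _ _ _) (e x))) z))
      (λ ¬e → sol φ false (λ x → trans (low φ x (lo x) (round-a x)) (dec-false (exit? _ _ _ _ _) (¬e x))))
      (λ t h x j → sol (b j) (lookup t j) (λ y → trans (low (b j) y (lo y) (round-a y)) (cong (λ u → lookup u j) (h y))) x)
      (λ h → sol ξ false λ x → trans (low ξ x (lo x) (round-a x))
        (leave-false (pt x ξ) (lowTube? (pt x) v (S v)) (atOrigin? (pt x))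
          ((λ k≤1 → proj₁ tube , at-a x , proj₁ (h x) k≤1) , proj₂ (h x))))
      (λ x φ≡0 at ¬back → let e = at-start ¬back in φ≡0 , subst (At (A x)) e (at-a x) , subst (At (B x)) e at)
      where
      five-not-lo : pt z φ ≢ 5
      five-not-lo e = contra (cong hi e) z-lo
      at-start : not (does (v ≟ᵛ origin)) ≡ false → v ≡ origin
      at-start e with v ≟ᵛ origin
      ... | yes v≡0 = v≡0
      ... | no _    = contra refl e

  module HighOnly (z : X) (z-hi : hi (pt z φ) ≡ true)
    (tube : highTube (pt z) (P (round (B z))) (round (B z))) where

    w : Vec Bool r
    w = round (B z)

    round-b : ∀ x → round (B x) ≡ w
    round-b x = near-round-b z x w (proj₁ (proj₂ tube))

    w≢origin : w ≢ origin
    w≢origin e = proj₁ tube (trans (cong P e) (trans P-origin (sym e)))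

    mixed : ∀ y → hi (pt y φ) ≡ false → ⊥
    mixed y y-lo with proj₂ (proj₂ tube)
    ... | inj₁ ψ≤1 = 2≰1 (≤-trans (∸-monoʳ-≤ 5 (≤-trans (proj₂ (near y z φ)) (s≤s (lo⇒≤2 y-lo)))) ψ≤1)
      where
      2≰1 : ¬ (2 ≤ 1)
      2≰1 (s≤s ())
    -- Passing through (w , w) needs an edge out of w. The low neighbour touches w, so `avoid`
    -- excludes that w is the end of the path.
    ... | inj₂ (inj₁ at) = Mixed.impossible w w round-a round-b y z y-lo z-hi
      (staying refl w≢origin (has-S w (λ e → avoid y (trans (touch-low S P (pt y) y-lo) (trans (round-a y) e)))
        (inj₂ (proj₁ tube))) (proj₁ tube))
      where
      round-a : ∀ x → round (A x) ≡ w
      round-a x = near-round-a z x w at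
    ... | inj₂ (inj₂ (at , _)) = Mixed.impossible (P w) w (λ x → near-round-a z x (P w) at) round-b y z y-lo z-hi
      (crossing (S∘P w (proj₁ tube)) refl (proj₁ tube))

    high-all : ∀ x → hi (pt x φ) ≡ true
    high-all x = ¬-not (mixed x)

    at-b : ∀ x → At (B x) w
    at-b x j = sol (b j) (lookup w j) (λ y → high (b j) y (high-all y) (round-b y)) x

    ψ-near : ∀ {k l} → l ≤ suc k → 2 ≤ 5 ∸ k → 1 ≤ 5 ∸ l
    ψ-near {k} {l} l≤1+k 2≤ = ≤-trans
      (≤-trans (pred-mono-≤ 2≤) (≤-reflexive (pred[m∸n]≡m∸[1+n] 5 k))) (∸-monoʳ-≤ 5 l≤1+k)

    impossible : ⊥
    impossible = Phase.impossible z (λ x → 5 ∸ pt x φ) (λ x → pt x ξ) A (P w) w true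
      (AtOrigin ∘ pt)
      (λ x y → ψ-near (proj₂ (near x y φ)))
      k-near near-round-a
      (λ e → zero-not-hi (sol φ false (λ x → trans (high φ x (high-all x) (round-b x))
        (cong not (dec-true (exit? _ _ _ _ _) (e x)))) z))
      (λ ¬e x → cong (5 ∸_) (sol φ true (λ x → trans (high φ x (high-all x) (round-b x))
        (cong not (dec-false (exit? _ _ _ _ _) (¬e x)))) x))
      (λ t h x j → sol (a j) (lookup t j) (λ y → trans (high (a j) y (high-all y) (round-b y)) (cong (λ u → lookup u j) (h y))) x)
      (λ h → sol ξ false λ x → trans (high ξ x (high-all x) (round-b x))
        (leave-false (pt x ξ) (highTube? (pt x) (P w) w) (atOrigin? (pt x))
          ((λ k≤1 → proj₁ tube , at-b x , proj₁ (h x) k≤1) , proj₂ (h x))))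
      (λ _ _ _ ())
      where
      zero-not-hi : pt z φ ≢ 0
      zero-not-hi e = contra z-hi (cong hi e)

  -- Since x touches the origin, `avoid` says that the path does not end there; the origin thus has
  -- a successor and x lies in the first low tube.
  at-origin : ∀ x → ¬ AtOrigin (pt x)
  at-origin x (φ≡0 , at-a , at-b) = LowOnly.impossible x (cong hi φ≡0)
    ( (λ e → has-S v (avoid x ∘ trans (touch-low S P (pt x) (cong hi φ≡0))) (inj₁ v≡0) (sym e))
    , subst (At (A x)) (sym v≡0) at-a , inj₁ (≤-trans (≤-reflexive φ≡0) z≤n) )
    where
    v = round (A x)
    v≡0 : v ≡ origin
    v≡0 = at-round at-a

  impossible : ⊥
  impossible = contra (cong hi (sol ξ true lift x₀)) (ξ-lo x₀)
    where
    lift : ∀ x → label S P (pt x) ξ ≡ true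
    lift x = cases (hi (pt x φ))
      (λ e → trans (high ξ x e refl) (leave-true (pt x ξ) (highTube? (pt x) _ _) (atOrigin? (pt x))
        (HighOnly.impossible x e) (at-origin x)))
      (λ e → trans (low ξ x e refl) (leave-true (pt x ξ) (lowTube? (pt x) _ _) (atOrigin? (pt x))
        (LowOnly.impossible x e) (at-origin x)))

-- Query algorithms and the path-extending adversary

branch : Bool → List (Vec Bool (suc r)) → List (Vec Bool r)
branch c []                    = []
branch false ((false ∷ v) ∷ T) = v ∷ branch false T
branch false ((true  ∷ v) ∷ T) = branch false T
branch true  ((false ∷ v) ∷ T) = branch true T
branch true  ((true  ∷ v) ∷ T) = v ∷ branch true T

∈-branch : ∀ {c} {v : Vec Bool r} {T} → c ∷ v ∈ T → v ∈ branch c T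
∈-branch {c = false} {T = _ ∷ _}           (here refl) = here refl
∈-branch {c = true}  {T = _ ∷ _}           (here refl) = here refl
∈-branch {c = false} {T = (false ∷ _) ∷ _} (there i)   = there (∈-branch i)
∈-branch {c = false} {T = (true  ∷ _) ∷ _} (there i)   = ∈-branch i
∈-branch {c = true}  {T = (false ∷ _) ∷ _} (there i)   = ∈-branch i
∈-branch {c = true}  {T = (true  ∷ _) ∷ _} (there i)   = there (∈-branch i)

length-branch : (T : List (Vec Bool (suc r))) →
  length (branch false T) + length (branch true T) ≡ length T
length-branch []                = refl
length-branch ((false ∷ v) ∷ T) = cong suc (length-branch T)
length-branch ((true  ∷ v) ∷ T) = trans (+-suc _ _) (cong suc (length-branch T))

-- Split by the first bit: the lengths of the two branches add up to that of T, so one of them is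
-- below half the bound.
fresh : (T : List (Vec Bool r)) → length T < 2 ^ r → ∃[ v ] v ∉ T
fresh {zero}  []      _ = [] , λ ()
fresh {zero}  (_ ∷ _) (s≤s ())
fresh {suc r} T |T|< with length (branch false T) <? 2 ^ r | length (branch true T) <? 2 ^ r
... | yes lt | _ = let v , v∉ = fresh _ lt in false ∷ v , v∉ ∘ ∈-branch
... | no _ | yes lt = let v , v∉ = fresh _ lt in true ∷ v , v∉ ∘ ∈-branch
... | no ge | no ge′ = ⊥-elim (<⇒≱ |T|< (subst₂ _≤_ (cong (2 ^ r +_) (sym (+-identityʳ _))) (length-branch T)
  (+-mono-≤ (≮⇒≥ ge) (≮⇒≥ ge′))))

queried : ∀ {A : Set} → QueryAlg N A → Oracle N → List (Vec Bool N)
queried (output _)    L = []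
queried (query x f t) L with L x
... | false = x ∷ queried f L
... | true  = x ∷ queried t L

run-cong : ∀ {A : Set} (𝒜 : QueryAlg N A) {L L′ : Oracle N} →
  (∀ x → x ∈ queried 𝒜 L → L x ≡ L′ x) → run 𝒜 L ≡ run 𝒜 L′
run-cong (output _) h = refl
run-cong (query x f t) {L} {L′} h with L x in e | L′ x in e′
... | false | false = run-cong f λ y y∈ → h y (there y∈)
... | true  | true  = run-cong t λ y y∈ → h y (there y∈)
... | false | true  with () ← trans (sym e) (trans (h x (here refl)) e′)
... | true  | false with () ← trans (sym e) (trans (h x (here refl)) e′)

_[_↦_] : (Vec Bool r → Vec Bool r) → Vec Bool r → Vec Bool r → Vec Bool r → Vec Bool r
(F [ v ↦ w ]) u with u ≟ᵛ v
... | yes _ = w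
... | no _  = F u

update-at : ∀ (F : Vec Bool r → Vec Bool r) v w → (F [ v ↦ w ]) v ≡ w
update-at F v w with v ≟ᵛ v
... | yes _ = refl
... | no ne = ⊥-elim (ne refl)

update-off : ∀ (F : Vec Bool r → Vec Bool r) {v w u} → u ≢ v → (F [ v ↦ w ]) u ≡ F u
update-off F {v} {w} {u} u≢v with u ≟ᵛ v
... | yes e = ⊥-elim (u≢v e)
... | no _  = refl

-- The last two fields prepare the next extension: by `S-end` no other vertex already points back to
-- `end`, and by `P-end` the old end satisfies `has-P` once it gains a successor.
record PathState (r : ℕ) : Set where
  constructor state
  field
    S P   : Vec Bool r → Vec Bool r
    end   : Vec Bool r
    path  : Path S P end
    S-end : S end ≡ end
    P-end : end ≢ origin → P end ≢ end

-- T collects the vertices touched so far. Isolation outside T is what allows a fresh vertex to be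
-- appended to the path.
record Explored (st : PathState r) (T : List (Vec Bool r)) : Set where
  open PathState st
  field
    end∉     : end ∉ T
    isolated : ∀ v → v ∉ T → v ≢ end → S v ≡ v × P v ≡ v × v ≢ origin

module Extend (st : PathState r) {T} (ex : Explored st T) (f : Vec Bool r) (f∉ : f ∉ PathState.end st ∷ T) where
  open PathState st
  open Path path
  open Explored ex

  f≢end : f ≢ end
  f≢end = f∉ ∘ here

  f-isolated : S f ≡ f × P f ≡ f × f ≢ origin
  f-isolated = isolated f (f∉ ∘ there) f≢end

  S⁺ P⁺ : Vec Bool r → Vec Bool r
  S⁺ = S [ end ↦ f ]
  P⁺ = P [ f ↦ end ]

  path⁺ : Path S⁺ P⁺ f
  path⁺ = record
    { P∘S      = λ v h → case-S v h
    ; S∘P      = λ v h → case-P v h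
    ; P-origin = trans (update-off P (proj₂ (proj₂ f-isolated) ∘ sym)) P-origin
    ; has-S    = case-has-S
    ; has-P    = case-has-P
    }
    where
    case-S : ∀ v → S⁺ v ≢ v → P⁺ (S⁺ v) ≡ v
    case-S v h with v ≟ᵛ end
    ... | yes refl = update-at P f end
    ... | no v≢end = trans (update-off P Sv≢f) (P∘S v h)
      where
      Sv≢f : S v ≢ f
      Sv≢f e = h (trans e (trans (sym (proj₁ (proj₂ f-isolated))) (trans (cong P (sym e)) (P∘S v h))))
    case-P : ∀ v → P⁺ v ≢ v → S⁺ (P⁺ v) ≡ v
    case-P v h with v ≟ᵛ f
    ... | yes refl = update-at S end f
    ... | no v≢f = trans (update-off S Pv≢end) (S∘P v h)
      where
      Pv≢end : P v ≢ end
      Pv≢end e = h (trans e (trans (sym S-end) (trans (cong S (sym e)) (S∘P v h))))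
    case-has-S : ∀ v → v ≢ f → v ≡ origin ⊎ P⁺ v ≢ v → S⁺ v ≢ v
    case-has-S v v≢f h with v ≟ᵛ end
    ... | yes refl = f≢end
    ... | no v≢end = has-S v v≢end (Sum.map₂ (subst (_≢ v) (update-off P v≢f)) h)
    case-has-P : ∀ v → v ≢ origin → S⁺ v ≢ v → P⁺ v ≢ v
    case-has-P v v≢0 h with v ≟ᵛ end
    ... | yes refl = subst (_≢ v) (sym (update-off P (f≢end ∘ sym))) (P-end v≢0)
    ... | no v≢end = subst (_≢ v) (sym (update-off P v≢f)) (has-P v v≢0 h)
      where
      v≢f : v ≢ f
      v≢f refl = h (proj₁ f-isolated)

  extended : PathState r
  extended = state S⁺ P⁺ f path⁺ (trans (update-off S f≢end) (proj₁ f-isolated))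
    (λ _ e → f≢end (trans (sym e) (update-at P f end)))

  explored : Explored extended (end ∷ T)
  explored = record
    { end∉     = f∉
    ; isolated = λ v v∉ v≢f → let S-v , P-v , v≢0 = isolated v (v∉ ∘ there) (v∉ ∘ here) in
        trans (update-off S (v∉ ∘ here)) S-v , trans (update-off P v≢f) P-v , v≢0
    }

initial : PathState r
initial = state (λ v → v) (λ v → v) origin
  (record { P∘S = λ v h → refl ; S∘P = λ v h → refl ; P-origin = refl
          ; has-S = λ { v v≢ (inj₁ e) _ → v≢ e ; v _ (inj₂ h) → h } ; has-P = λ v _ h → h })
  refl (λ h _ → h refl)

initial-explored : Explored {r} initial []
initial-explored = record { end∉ = λ () ; isolated = λ v _ v≢ → refl , refl , v≢ }

module Adversary {r N : ℕ} {A : Set}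
  (oracle : (S P : Vec Bool r → Vec Bool r) → Oracle N)
  (touched : Vec Bool N → Vec Bool r)
  (oracle-cong : ∀ S S′ P P′ x → S (touched x) ≡ S′ (touched x) → P (touched x) ≡ P′ (touched x) →
    oracle S P x ≡ oracle S′ P′ x)
  where
  open PathState

  oracleOf : PathState r → Oracle N
  oracleOf st = oracle (S st) (P st)

  Evades : QueryAlg N A → List (Vec Bool r) → PathState r → Set
  Evades 𝒜 T st =
    2 ^ r ≤ length T + queries 𝒜 (oracleOf st)
    ⊎ (∀ x → x ∈ queried 𝒜 (oracleOf st) → touched x ≢ end st)

  Agree : PathState r → PathState r → List (Vec Bool r) → Set
  Agree st st′ T = ∀ x → touched x ∈ T → oracleOf st x ≡ oracleOf st′ x

  -- Earlier answers survive because an extension changes S only at the old end and P only at the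
  -- fresh vertex, both outside T.
  evade : (𝒜 : QueryAlg N A) (T : List (Vec Bool r)) (st : PathState r) → Explored st T →
    ∃[ st′ ] Agree st st′ T × end st′ ∉ T × Evades 𝒜 T st′
  evade (output _) T st ex = st , (λ _ _ → refl) , Explored.end∉ ex , inj₂ λ _ ()
  evade (query x f t) T st ex with length (touched x ∷ T) <? 2 ^ r
  ... | no ge = st , (λ _ _ → refl) , Explored.end∉ ex , inj₁ (≤-trans (≮⇒≥ ge) many)
    where
    many : suc (length T) ≤ length T + queries (query x f t) (oracleOf st)
    many with oracleOf st x
    ... | false = subst (suc (length T) ≤_) (sym (+-suc _ _)) (s≤s (m≤m+n _ _))
    ... | true  = subst (suc (length T) ≤_) (sym (+-suc _ _)) (s≤s (m≤m+n _ _))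
  ... | yes lt = answer
    where
    -- The path is moved past the touched vertex before the query is answered, so the answer never
    -- concerns the current end.
    settle : ∃[ st₁ ] Agree st st₁ T × Explored st₁ (touched x ∷ T)
    settle with touched x ≟ᵛ end st
    ... | no ≢end = st , (λ _ _ → refl) , record
      { end∉ = λ { (here e) → ≢end (sym e) ; (there i) → Explored.end∉ ex i }
      ; isolated = λ v v∉ → Explored.isolated ex v (v∉ ∘ there) }
    ... | yes ≡end = extended , agree , subst (λ v → Explored extended (v ∷ T)) (sym ≡end) explored
      where
      new = fresh (touched x ∷ T) lt
      open Extend st ex (proj₁ new) (subst (λ v → proj₁ new ∉ v ∷ T) ≡end (proj₂ new))
      agree : Agree st extended T
      agree y y∈ = oracle-cong (S st) S⁺ (P st) P⁺ y
        (sym (update-off (S st) λ e → Explored.end∉ ex (subst (_∈ T) e y∈)))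
        (sym (update-off (P st) λ e → proj₂ new (there (subst (_∈ T) e y∈))))
    continue : (c : Bool) (𝒜 : QueryAlg N A) →
      (∀ L → L x ≡ c → queries (query x f t) L ≡ suc (queries 𝒜 L) × queried (query x f t) L ≡ x ∷ queried 𝒜 L) →
      oracleOf (proj₁ settle) x ≡ c →
      ∃[ st′ ] Agree (proj₁ settle) st′ (touched x ∷ T) × end st′ ∉ touched x ∷ T × Evades 𝒜 (touched x ∷ T) st′ →
      ∃[ st′ ] Agree st st′ T × end st′ ∉ T × Evades (query x f t) T st′
    continue c 𝒜 step eq (st′ , agree , end∉ , ev) =
      st′ , (λ y y∈ → trans (proj₁ (proj₂ settle) y y∈) (agree y (there y∈))) , end∉ ∘ there , evades ev
      where
      -- The vertex of x now belongs to the protected list, so the final oracle still takes the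
      -- branch chosen here.
      steps = step (oracleOf st′) (trans (sym (agree x (here refl))) eq)
      evades : Evades 𝒜 (touched x ∷ T) st′ → Evades (query x f t) T st′
      evades (inj₁ h) = inj₁ (subst (2 ^ r ≤_) (trans (sym (+-suc _ _)) (cong (length T +_) (sym (proj₁ steps)))) h)
      evades (inj₂ h) = inj₂ λ y y∈ → case-∈ y (subst (y ∈_) (proj₂ steps) y∈)
        where
        case-∈ : ∀ y → y ∈ x ∷ queried 𝒜 (oracleOf st′) → touched y ≢ end st′
        case-∈ y (here refl) e = end∉ (here (sym e))
        case-∈ y (there y∈)    = h y y∈
    step-false : ∀ L → L x ≡ false → queries (query x f t) L ≡ suc (queries f L) × queried (query x f t) L ≡ x ∷ queried f L
    step-false L e rewrite e = refl , refl
    step-true : ∀ L → L x ≡ true → queries (query x f t) L ≡ suc (queries t L) × queried (query x f t) L ≡ x ∷ queried t L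
    step-true L e rewrite e = refl , refl
    answer : ∃[ st′ ] Agree st st′ T × end st′ ∉ T × Evades (query x f t) T st′
    answer = cases (oracleOf (proj₁ settle) x)
      (λ e → continue true t step-true e (evade t (touched x ∷ T) (proj₁ settle) (proj₂ (proj₂ settle))))
      (λ e → continue false f step-false e (evade f (touched x ∷ T) (proj₁ settle) (proj₂ (proj₂ settle))))

-- Circuits with named gates, realized on Fin n

toList-tabulate : ∀ {A : Set} {n} (f : Fin n → A) → toList (Vec.tabulate f) ≡ List.tabulate f
toList-tabulate {n = zero}  f = refl
toList-tabulate {n = suc n} f = cong (f zero ∷_) (toList-tabulate (f ∘ suc))

module _ {A B : Set} (f : A → List B) where

  ∈-concat-tabulate⁺ : ∀ {m} (g : Fin m → A) k {x} → x ∈ f (g k) → x ∈ concatMap f (List.tabulate g)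
  ∈-concat-tabulate⁺ g zero    x∈ = ∈-++⁺ˡ x∈
  ∈-concat-tabulate⁺ g (suc k) x∈ = ∈-++⁺ʳ (f (g zero)) (∈-concat-tabulate⁺ (g ∘ suc) k x∈)

  ∈-concat-tabulate⁻ : ∀ {m} (g : Fin m → A) {x} → x ∈ concatMap f (List.tabulate g) → ∃[ k ] x ∈ f (g k)
  ∈-concat-tabulate⁻ {suc m} g x∈ with ∈-++⁻ (f (g zero)) x∈
  ... | inj₁ x∈ˡ = zero , x∈ˡ
  ... | inj₂ x∈ʳ = let k , x∈k = ∈-concat-tabulate⁻ (g ∘ suc) x∈ʳ in suc k , x∈k

  unique-concat-tabulate : ∀ {m} (g : Fin m → A) → (∀ k → Unique (f (g k))) →
    (∀ k l {x} → x ∈ f (g k) → x ∈ f (g l) → k ≡ l) → Unique (concatMap f (List.tabulate g))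
  unique-concat-tabulate {zero}  g un sep = []
  unique-concat-tabulate {suc m} g un sep = ++⁺ (un zero)
    (unique-concat-tabulate (g ∘ suc) (un ∘ suc) λ k l x∈ x∈′ → suc-injective (sep (suc k) (suc l) x∈ x∈′))
    λ (x∈ , x∈′) → let k , x∈k = ∈-concat-tabulate⁻ (g ∘ suc) x∈′ in case-zero (sep zero (suc k) x∈ x∈k)
    where
    case-zero : ∀ {k : Fin m} → ¬ (zero ≡ suc k)
    case-zero ()

data Node (A P O : Set) : Set where
  nor        : A → Node A P O
  left right : P → Node A P O
  orc        : O → Node A P O

record Circuit (A P O J : Set) : Set where
  field
    norL norR : A → Node A P O
    purIn     : P → Node A P O
    orcIn     : O → J → Node A P O
    norL≢norR : ∀ g → norL g ≢ norR g
    norL≢out  : ∀ g → norL g ≢ nor g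
    norR≢out  : ∀ g → norR g ≢ nor g
    purIn≢left  : ∀ g → purIn g ≢ left g
    purIn≢right : ∀ g → purIn g ≢ right g
    orcIn-injective : ∀ g {i j} → orcIn g i ≡ orcIn g j → i ≡ j
    orcIn≢out : ∀ g j → orcIn g j ≢ orc g

module Realize {A P O J : Set} (C : Circuit A P O J) {a p o n N : ℕ}
  (iA : A ↔ Fin a) (iP : P ↔ Fin p) (iO : O ↔ Fin o) (iJ : J ↔ Fin N) (iNode : Node A P O ↔ Fin n)
  (o₀ : O) where
  open Circuit C

  to : ∀ {X : Set} {m} → X ↔ Fin m → X → Fin m
  to = Inverse.to

  from : ∀ {X : Set} {m} → X ↔ Fin m → Fin m → X
  from = Inverse.from

  to-injective : ∀ {X : Set} {m} (i : X ↔ Fin m) {x y} → to i x ≡ to i y → x ≡ y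
  to-injective i e = trans (sym (Inverse.strictlyInverseʳ i _)) (trans (cong (from i) e) (Inverse.strictlyInverseʳ i _))

  from-injective : ∀ {X : Set} {m} (i : X ↔ Fin m) {x y} → from i x ≡ from i y → x ≡ y
  from-injective i e = trans (sym (Inverse.strictlyInverseˡ i _)) (trans (cong (to i) e) (Inverse.strictlyInverseˡ i _))

  enc : Node A P O → Fin n
  enc = to iNode

  norGate : A → Fin n × Fin n × Fin n
  norGate g = enc (norL g) , enc (norR g) , enc (nor g)

  purGate : P → Fin n × Fin n × Fin n
  purGate g = enc (purIn g) , enc (left g) , enc (right g)

  orcGate : O → Vec (Fin n) N × Fin n
  orcGate g = Vec.tabulate (enc ∘ orcIn g ∘ from iJ) , enc (orc g)

  inputs-injective : ∀ g {i j} → enc (orcIn g (from iJ i)) ≡ enc (orcIn g (from iJ j)) → i ≡ j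
  inputs-injective g = from-injective iJ ∘ orcIn-injective g ∘ to-injective iNode

  inst : Instance n N
  inst = record
    -- The inputs of a single oracle gate are already N distinct nodes.
    { N≤V         = injective⇒≤ (inputs-injective o₀)
    ; norGates    = List.tabulate (norGate ∘ from iA)
    ; purifyGates = List.tabulate (purGate ∘ from iP)
    ; oracleGates = List.tabulate (orcGate ∘ from iO)
    }

  ≢enc : ∀ {u v} → u ≢ v → enc u ≢ enc v
  ≢enc ne = ne ∘ to-injective iNode

  unique-triple : ∀ {u v w : Fin n} → u ≢ v → u ≢ w → v ≢ w → Unique (u ∷ v ∷ w ∷ [])
  unique-triple p q r = (p ∷ q ∷ []) ∷ (r ∷ []) ∷ [] ∷ []

  left≢right : ∀ {g h} → left {A} {P} {O} g ≢ right h
  left≢right ()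

  unique-orc : ∀ g → Unique (oracleNodes {n} {N} (orcGate g))
  unique-orc g rewrite toList-tabulate (enc ∘ orcIn g ∘ from iJ) =
    ++⁺ (unique-tabulate (inputs-injective g)) ([] ∷ [])
      λ { (v∈ , here refl) → let j , e = ∈-tabulate⁻ v∈ in ≢enc (orcIn≢out g (from iJ j)) (sym e) }

  nor-outputs pur-outputs : List (Fin n)
  nor-outputs = concatMap (λ { (u , v , w) → w ∷ [] }) (norGates inst)
  pur-outputs = concatMap (λ { (u , v , w) → v ∷ w ∷ [] }) (purifyGates inst)

  orc-outputs : List (Fin n)
  orc-outputs = concatMap (λ { (us , v) → v ∷ [] }) (oracleGates inst)

  private
    dec≡ : ∀ {u v} → enc u ≡ enc v → u ≡ v
    dec≡ = to-injective iNode

  unique-nor : Unique nor-outputs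
  unique-nor = unique-concat-tabulate _ (norGate ∘ from iA) (λ _ → [] ∷ [])
    λ { k l (here refl) (here e) → from-injective iA (nor-injective (dec≡ e)) }
    where
    nor-injective : ∀ {g h} → nor {A} {P} {O} g ≡ nor h → g ≡ h
    nor-injective refl = refl

  unique-pur : Unique pur-outputs
  unique-pur = unique-concat-tabulate _ (purGate ∘ from iP) (λ _ → (≢enc left≢right ∷ []) ∷ [] ∷ []) sep
    where
    left-injective : ∀ {g h} → left {A} {P} {O} g ≡ left h → g ≡ h
    left-injective refl = refl
    right-injective : ∀ {g h} → right {A} {P} {O} g ≡ right h → g ≡ h
    right-injective refl = refl
    sep : ∀ k l {x} → x ∈ enc (left (from iP k)) ∷ enc (right (from iP k)) ∷ [] →
      x ∈ enc (left (from iP l)) ∷ enc (right (from iP l)) ∷ [] → k ≡ l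
    sep k l (here refl)         (here e)         = from-injective iP (left-injective (dec≡ e))
    sep k l (there (here refl)) (there (here e)) = from-injective iP (right-injective (dec≡ e))
    sep k l (here refl)         (there (here e)) with () ← dec≡ e
    sep k l (there (here refl)) (here e)         with () ← dec≡ e

  unique-orcs : Unique orc-outputs
  unique-orcs = unique-concat-tabulate _ (orcGate ∘ from iO) (λ _ → [] ∷ [])
    λ { k l (here refl) (here e) → from-injective iO (orc-injective (dec≡ e)) }
    where
    orc-injective : ∀ {g h} → orc {A} {P} {O} g ≡ orc h → g ≡ h
    orc-injective refl = refl

  unique-outputs : Unique (outputs inst)
  unique-outputs = ++⁺ unique-nor (++⁺ unique-pur unique-orcs pur#orc) nor#rest
    where
    pur#orc : ∀ {x} → ¬ (x ∈ pur-outputs × x ∈ orc-outputs)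
    pur#orc (x∈ , x∈′) with ∈-concat-tabulate⁻ _ (purGate ∘ from iP) x∈ | ∈-concat-tabulate⁻ _ (orcGate ∘ from iO) x∈′
    ... | _ , here refl         | _ , here e with () ← dec≡ e
    ... | _ , there (here refl) | _ , here e with () ← dec≡ e
    nor#rest : ∀ {x} → ¬ (x ∈ nor-outputs × x ∈ pur-outputs ++ orc-outputs)
    nor#rest (x∈ , x∈′) with ∈-concat-tabulate⁻ _ (norGate ∘ from iA) x∈ | ∈-++⁻ pur-outputs x∈′
    nor#rest (x∈ , x∈′) | _ , here refl | inj₁ h with ∈-concat-tabulate⁻ _ (purGate ∘ from iP) h
    ... | _ , here e         with () ← dec≡ e
    ... | _ , there (here e) with () ← dec≡ e
    nor#rest (x∈ , x∈′) | _ , here refl | inj₂ h with ∈-concat-tabulate⁻ _ (orcGate ∘ from iO) h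
    ... | _ , here e with () ← dec≡ e

  output-enc : ∀ u → enc u ∈ outputs inst
  output-enc (nor g)   = ∈-++⁺ˡ (∈-concat-tabulate⁺ _ (norGate ∘ from iA) (to iA g)
    (here (cong (enc ∘ nor) (sym (Inverse.strictlyInverseʳ iA g)))))
  output-enc (left g)  = ∈-++⁺ʳ nor-outputs (∈-++⁺ˡ (∈-concat-tabulate⁺ _ (purGate ∘ from iP) (to iP g)
    (here (cong (enc ∘ left) (sym (Inverse.strictlyInverseʳ iP g))))))
  output-enc (right g) = ∈-++⁺ʳ nor-outputs (∈-++⁺ˡ (∈-concat-tabulate⁺ _ (purGate ∘ from iP) (to iP g)
    (there (here (cong (enc ∘ right) (sym (Inverse.strictlyInverseʳ iP g)))))))
  output-enc (orc g)   = ∈-++⁺ʳ nor-outputs (∈-++⁺ʳ pur-outputs (∈-concat-tabulate⁺ _ (orcGate ∘ from iO) (to iO g)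
    (here (cong (enc ∘ orc) (sym (Inverse.strictlyInverseʳ iO g))))))

  wellFormed : WellFormed inst
  wellFormed =
      tabulate⁺ (λ k → unique-triple (≢enc (norL≢norR _)) (≢enc (norL≢out _)) (≢enc (norR≢out _)))
    , tabulate⁺ (λ k → unique-triple (≢enc (purIn≢left _)) (≢enc (purIn≢right _)) (≢enc left≢right))
    , tabulate⁺ (λ k → unique-orc (from iO k))
    , unique-outputs
    , λ x → subst (_∈ outputs inst) (Inverse.strictlyInverseˡ iNode x) (output-enc (from iNode x))

  inputBits : (J → Bool) → Vec Bool N
  inputBits xs = Vec.tabulate (xs ∘ from iJ)

  read : Vec Bool N → J → Bool
  read xs j = lookup xs (to iJ j)

  read-inputBits : ∀ xs j → read (inputBits xs) j ≡ xs j
  read-inputBits xs j = trans (lookup∘tabulate _ (to iJ j)) (cong xs (Inverse.strictlyInverseʳ iJ j))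

  module Solution {L : Oracle N} {β : Assignment n} (sol : IsSolution inst L β) where

    val : Node A P O → Val
    val = β ∘ enc

    nor-ok : ∀ g → (val (norL g) ≡ v0 → val (norR g) ≡ v0 → val (nor g) ≡ v1)
                 × (val (norL g) ≡ v1 ⊎ val (norR g) ≡ v1 → val (nor g) ≡ v0)
    nor-ok g = subst (λ g → NorOK β (norGate g)) (Inverse.strictlyInverseʳ iA g)
      (tabulate⁻ (proj₁ sol) (to iA g))

    pur-ok : ∀ g → (IsBit (val (left g)) ⊎ IsBit (val (right g)))
                 × (∀ x → val (purIn g) ≡ bit x → val (left g) ≡ bit x × val (right g) ≡ bit x)
    pur-ok g = subst (λ g → PurifyOK β (purGate g)) (Inverse.strictlyInverseʳ iP g)
      (tabulate⁻ (proj₁ (proj₂ sol)) (to iP g))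

    orc-ok : ∀ g (xs : J → Bool) → (∀ j → val (orcIn g j) ≡ bit (xs j)) → val (orc g) ≡ bit (L (inputBits xs))
    orc-ok g xs h = subst (λ g → OracleOK L β (orcGate g)) (Inverse.strictlyInverseʳ iO g)
      (tabulate⁻ (proj₂ (proj₂ sol)) (to iO g)) (inputBits xs)
      (trans (sym (tabulate-∘ β (enc ∘ orcIn g ∘ from iJ)))
        (trans (tabulate-cong (h ∘ from iJ)) (tabulate-∘ bit (xs ∘ from iJ))))

  module _ (𝒜 : QueryAlg N (Assignment n)) (solves : Solves inst 𝒜) where

    flip : Vec Bool N → Oracle N → Oracle N
    flip x L y with ≡-dec _≟ᵇ_ y x
    ... | yes _ = not (L y)
    ... | no _  = L y

    -- Otherwise flipping L at that input would leave the output unchanged but wrong.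
    inputs-queried : ∀ L g (xs : J → Bool) →
      (∀ j → run 𝒜 L (enc (orcIn g j)) ≡ bit (xs j)) → inputBits xs ∈ queried 𝒜 L
    inputs-queried L g xs pure = decidable-stable (inputBits xs ∈? queried 𝒜 L) λ ∉ →
      not-¬ {L x} refl (bit-injective (trans (sym (Solution.orc-ok (solves L) g xs pure))
        (trans (cong (λ β → β (enc (orc g))) (run-same ∉))
          (trans (Solution.orc-ok (solves (flip x L)) g xs (λ j → trans (sym (cong (λ β → β (enc (orcIn g j))) (run-same ∉))) (pure j)))
            (cong bit flip-at)))))
      where
      open import Data.List.Membership.DecPropositional (≡-dec _≟ᵇ_) using (_∈?_)
      x = inputBits xs
      bit-injective : ∀ {c c′} → bit c ≡ bit c′ → c ≡ c′
      bit-injective {false} {false} _ = refl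
      bit-injective {true}  {true}  _ = refl
      flip-at : flip x L x ≡ not (L x)
      flip-at with ≡-dec _≟ᵇ_ x x
      ... | yes _ = refl
      ... | no ne = ⊥-elim (ne refl)
      run-same : x ∉ queried 𝒜 L → run 𝒜 L ≡ run 𝒜 (flip x L)
      run-same ∉ = run-cong 𝒜 same
        where
        same : ∀ y → y ∈ queried 𝒜 L → L y ≡ flip x L y
        same y y∈ with ≡-dec _≟ᵇ_ y x
        ... | yes refl = ⊥-elim (∉ y∈)
        ... | no _     = refl

-- The circuit and its pure copies

NorSem : Val → Val → Val → Set
NorSem u v w = (u ≡ v0 → v ≡ v0 → w ≡ v1) × (u ≡ v1 ⊎ v ≡ v1 → w ≡ v0)

PurSem : Val → Val → Val → Set
PurSem u v w = (IsBit v ⊎ IsBit w) × (∀ x → u ≡ bit x → v ≡ bit x × w ≡ bit x)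

toBool : Val → Bool
toBool v1 = true
toBool _  = false

isBit-≡ : ∀ {v} → IsBit v → v ≡ bit (toBool v)
isBit-≡ (isBit false) = refl
isBit-≡ (isBit true)  = refl

bit-isBit : ∀ {v x} → v ≡ bit x → IsBit v
bit-isBit refl = isBit _

isBit? : ∀ v → Dec (IsBit v)
isBit? v0 = yes (isBit false)
isBit? v1 = yes (isBit true)
isBit? v⊥ = no λ p → v⊥≢v0 (isBit-≡ p)
  where
  v⊥≢v0 : v⊥ ≢ v0
  v⊥≢v0 ()

toBool-bit : ∀ {v} x → v ≡ bit x → toBool v ≡ x
toBool-bit false refl = refl
toBool-bit true  refl = refl

prev : ∀ {X : Set} {m} → X → (Fin m → X) → Fin m → X
prev s f zero    = s
prev s f (suc k) = f (inject₁ k)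

prev-suc : ∀ {X : Set} {m} (s : X) (f : Fin (suc m) → X) (k : Fin m) →
  prev (f zero) (f ∘ suc) k ≡ prev s f (suc k)
prev-suc s f zero    = refl
prev-suc s f (suc k) = refl

prev-∘ : ∀ {X Y : Set} {m} (h : X → Y) s (f : Fin m → X) k → h (prev s f k) ≡ prev (h s) (h ∘ f) k
prev-∘ h s f zero    = refl
prev-∘ h s f (suc k) = refl

purify-pure : ∀ {m} {s : Val} {l r : Fin m → Val} → (∀ k → PurSem (prev s r k) (l k) (r k)) →
  ∀ {x} → s ≡ bit x → ∀ k → l k ≡ bit x
purify-pure ok s≡ zero = proj₁ (proj₂ (ok zero) _ s≡)
purify-pure {suc m} {s} {l} {r} ok s≡ (suc k) = purify-pure {l = l ∘ suc} {r ∘ suc}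
  (λ k → subst (λ u → PurSem u (l (suc k)) (r (suc k))) (sym (prev-suc s r k)) (ok (suc k)))
  (proj₂ (proj₂ (ok zero) _ s≡)) k

-- An impure left output forces its right output to be a bit, which then fixes all later outputs.
purify-one-bad : ∀ {m} {s : Val} {l r : Fin (suc m) → Val} → (∀ k → PurSem (prev s r k) (l k) (r k)) →
  ∃[ k₀ ] ∀ k → k ≢ k₀ → IsBit (l k)
purify-one-bad {m} {s} {l} {r} ok with isBit? (l zero)
... | no ¬bit = zero , λ
  { zero    ne → ⊥-elim (ne refl)
  ; (suc k) _  → bit-isBit (purify-pure {l = l ∘ suc} {r ∘ suc}
      (λ k → subst (λ u → PurSem u (l (suc k)) (r (suc k))) (sym (prev-suc s r k)) (ok (suc k)))
      (isBit-≡ (fromInj₂ (⊥-elim ∘ ¬bit) (proj₁ (ok zero)))) k) }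
purify-one-bad {zero}  ok | yes isb = zero , λ { zero _ → isb }
purify-one-bad {suc m} {s} {l} {r} ok | yes isb =
  let k₀ , h = purify-one-bad {l = l ∘ suc} {r ∘ suc}
                 (λ k → subst (λ u → PurSem u (l (suc k)) (r (suc k))) (sym (prev-suc s r k)) (ok (suc k)))
  in suc k₀ , λ { zero _ → isb ; (suc k) ne → h k (ne ∘ cong suc) }

-- The sequence o is the running OR of s and the y's, each step negating n by a NOR with the
-- constant 0; the last n is their NOR.
record NorChain {m} (s : Val) (y n o : Fin m → Val) : Set where
  field
    nor-step : ∀ k → NorSem (prev s o k) (y k) (n k)
    not-step : ∀ k → NorSem (n k) v0 (o k)

open NorChain

tail-chain : ∀ {m s} {y n o : Fin (suc m) → Val} → NorChain s y n o →
  NorChain (o zero) (y ∘ suc) (n ∘ suc) (o ∘ suc)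
tail-chain {s = s} {y} {n} {o} c = record
  { nor-step = λ k → subst (λ u → NorSem u (y (suc k)) (n (suc k))) (sym (prev-suc s o k)) (nor-step c (suc k))
  ; not-step = not-step c ∘ suc
  }

chain-silent : ∀ {m s} {y n o : Fin (suc m) → Val} → NorChain s y n o →
  s ≡ v0 → (∀ k → y k ≡ v0) → n (fromℕ m) ≡ v1
chain-silent {zero}  c s≡ y≡ = proj₁ (nor-step c zero) s≡ (y≡ zero)
chain-silent {suc m} c s≡ y≡ = chain-silent (tail-chain c)
  (proj₂ (not-step c zero) (inj₁ (proj₁ (nor-step c zero) s≡ (y≡ zero)))) (y≡ ∘ suc)

chain-fires : ∀ {m s} {y n o : Fin (suc m) → Val} → NorChain s y n o →
  s ≡ v1 ⊎ (∃[ k ] y k ≡ v1) → n (fromℕ m) ≡ v0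
chain-fires {zero}  c (inj₁ s≡)              = proj₂ (nor-step c zero) (inj₁ s≡)
chain-fires {zero}  c (inj₂ (zero , y≡))     = proj₂ (nor-step c zero) (inj₂ y≡)
chain-fires {suc m} c (inj₂ (suc k , y≡))    = chain-fires (tail-chain c) (inj₂ (k , y≡))
chain-fires {suc m} c (inj₁ s≡)              = chain-fires (tail-chain c)
  (inj₁ (proj₁ (not-step c zero) (proj₂ (nor-step c zero) (inj₁ s≡)) refl))
chain-fires {suc m} c (inj₂ (zero , y≡))     = chain-fires (tail-chain c)
  (inj₁ (proj₁ (not-step c zero) (proj₂ (nor-step c zero) (inj₂ y≡)) refl))

-- If every value were hit, a section of f would inject d + 1 elements into d.
missed : ∀ {d} (f : Fin d → Fin (suc d)) → ∃[ g ] ∀ i → g ≢ f i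
missed {d} f with any? (λ g → all? λ i → ¬? (g ≟ f i))
... | yes h = h
... | no ¬h = ⊥-elim (i≢j (trans (sym (hit i)) (trans (cong f e) (hit j))))
  where
  section : ∀ g → ∃[ i ] f i ≡ g
  section g = decidable-stable (any? λ i → f i ≟ g) λ ¬∃ → ¬h (g , λ i e → ¬∃ (i , sym e))
  hit : ∀ g → f (proj₁ (section g)) ≡ g
  hit g = proj₂ (section g)
  collision = pigeonhole (n<1+n d) (proj₁ ∘ section)
  i = proj₁ collision
  j = proj₁ (proj₂ collision)
  e = proj₂ (proj₂ (proj₂ collision))
  i≢j = <⇒≢ (proj₁ (proj₂ (proj₂ collision)))

-- Each of the D coordinates spoils at most one of its K copies, so arranging the copies in an M × M grid with
-- M = D + 1 leaves a row and a column without spoiled copies; NOR of NORs then reports every unanimous answer.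
module Tally (q d : ℕ) where

  D M K : ℕ
  D = suc d
  M = suc D
  K = M * M

  -- Every node is a gate output, so constants must be generated inside: `seedP`, `notG`, `deadG`
  -- and `liveG` do this. `padG` brings the number of nodes up to a prescribed n.
  NorGate PurGate OrcGate Slot : Set
  NorGate = Fin q ⊎ Bool ⊎ (Fin 3 × Bool) ⊎ (Bool × Fin D × Fin (suc M) × Fin M)
  PurGate = Fin 1 ⊎ (Bool × Bool) ⊎ Fin D ⊎ (Fin D × Fin 5) ⊎ (Fin D × Fin 5 × Fin K)
  OrcGate = Fin D × Fin M × Fin M
  Slot    = Fin D ⊎ (Fin D × Fin 5)

  pattern padG k     = inj₁ k
  pattern zeroG      = inj₂ (inj₁ false)
  pattern oneG       = inj₂ (inj₁ true)
  pattern notG t     = inj₂ (inj₂ (inj₁ (zero , t)))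
  pattern deadG t    = inj₂ (inj₂ (inj₁ (suc zero , t)))
  pattern liveG t    = inj₂ (inj₂ (inj₁ (suc (suc zero) , t)))
  pattern norG i g k = inj₂ (inj₂ (inj₂ (false , i , g , k)))
  pattern orG i g k  = inj₂ (inj₂ (inj₂ (true , i , g , k)))

  pattern seedP       = inj₁ zero
  pattern splitP t    = inj₂ (inj₁ (false , t))
  pattern deadP t     = inj₂ (inj₁ (true , t))
  pattern zeroP l     = inj₂ (inj₂ (inj₁ l))
  pattern bitP i j    = inj₂ (inj₂ (inj₂ (inj₁ (i , j))))
  pattern copyP i j κ = inj₂ (inj₂ (inj₂ (inj₂ (i , j , κ))))

  Nd : Set
  Nd = Node NorGate PurGate OrcGate

  seed : Bool → Nd
  seed false = left seedP
  seed true  = right seedP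

  -- The chains with index suc g read row g of the grid, the chain zero collects the row results.
  feed : Fin D → Fin (suc M) → Fin M → Nd
  feed i (suc g) k = orc (i , g , k)
  feed i zero    k = nor (norG i (suc k) (fromℕ D))

  u : Fin D → Nd
  u i = nor (norG i zero (fromℕ D))

  -- The nodes of a gate must be distinct, so a negation reads two purified copies of its argument,
  -- and `oneG` two different zeros.
  norL norR : NorGate → Nd
  norL (padG k)     = nor zeroG
  norL zeroG        = nor (liveG false)
  norL oneG         = left (zeroP zero)
  norL (notG t)     = left (splitP t)
  norL (deadG t)    = seed t
  norL (liveG t)    = left (deadP t)
  norL (norG i g k) = prev (nor zeroG) (λ k → nor (orG i g k)) k
  norL (orG i g k)  = nor (norG i g k)
  norR (padG k)     = nor oneG
  norR zeroG        = nor (liveG true)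
  norR oneG         = nor zeroG
  norR (notG t)     = right (splitP t)
  norR (deadG t)    = nor (notG t)
  norR (liveG t)    = right (deadP t)
  norR (norG i g k) = feed i g k
  norR (orG i g k)  = nor zeroG

  purIn : PurGate → Nd
  purIn seedP         = nor oneG
  purIn (splitP t)    = seed t
  purIn (deadP t)     = nor (deadG t)
  purIn (zeroP l)     = prev (nor zeroG) (λ l → right (zeroP l)) l
  purIn (bitP i j)    = prev (u i) (λ j → right (bitP i j)) j
  purIn (copyP i j κ) = prev (left (bitP i j)) (λ κ → right (copyP i j κ)) κ

  -- A one-hot code of the coordinate asked for. It uses a separate copy of 0 per position, again to
  -- keep the inputs distinct.
  selector : Fin D → Fin D → Nd
  selector i l with i ≟ l
  ... | yes _ = nor oneG
  ... | no _  = left (zeroP l)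

  orcIn : OrcGate → Slot → Nd
  orcIn (i , g , h) (inj₁ l)       = selector i l
  orcIn (i , g , h) (inj₂ (l , j)) = left (copyP l j (combine g h))

  inject₁≢suc : ∀ {m} (k : Fin m) → inject₁ k ≢ suc k
  inject₁≢suc (suc k) e = inject₁≢suc k (suc-injective e)

  circuit : Circuit NorGate PurGate OrcGate Slot
  circuit = record
    { norL = norL ; norR = norR ; purIn = purIn ; orcIn = orcIn
    ; norL≢norR = λ
      { (padG k) () ; zeroG () ; oneG () ; (notG t) ()
      ; (deadG false) () ; (deadG true) () ; (liveG t) ()
      ; (norG i zero zero) () ; (norG i zero (suc k)) () ; (norG i (suc g) zero) () ; (norG i (suc g) (suc k)) ()
      ; (orG i g k) () }
    ; norL≢out = λ
      { (padG k) () ; zeroG () ; oneG () ; (notG t) ()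
      ; (deadG false) () ; (deadG true) () ; (liveG t) ()
      ; (norG i g zero) () ; (norG i g (suc k)) () ; (orG i g k) () }
    ; norR≢out = λ
      { (padG k) () ; zeroG () ; oneG () ; (notG t) () ; (deadG t) () ; (liveG t) ()
      ; (norG i zero k) () ; (norG i (suc g) k) () ; (orG i g k) () }
    ; purIn≢left = λ
      { seedP () ; (splitP false) () ; (splitP true) () ; (deadP t) ()
      ; (zeroP zero) () ; (zeroP (suc l)) () ; (bitP i zero) () ; (bitP i (suc j)) ()
      ; (copyP i j zero) () ; (copyP i j (suc κ)) () }
    ; purIn≢right = λ
      { seedP () ; (splitP false) () ; (splitP true) () ; (deadP t) ()
      ; (zeroP zero) () ; (zeroP (suc l)) e → inject₁≢suc l (zeroP-inj e)
      ; (bitP i zero) () ; (bitP i (suc j)) e → inject₁≢suc j (bitP-inj e)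
      ; (copyP i j zero) () ; (copyP i j (suc κ)) e → inject₁≢suc κ (copyP-inj e) }
    ; orcIn-injective = λ g → orcIn-inj g _ _
    ; orcIn≢out = λ { (i , g , h) (inj₁ l) → selector≢orc i l ; (i , g , h) (inj₂ _) () }
    }
    where
    zeroP-inj : ∀ {l l′} → right {NorGate} {PurGate} {OrcGate} (zeroP l) ≡ right (zeroP l′) → l ≡ l′
    zeroP-inj refl = refl
    bitP-inj : ∀ {i j j′} → right {NorGate} {PurGate} {OrcGate} (bitP i j) ≡ right (bitP i j′) → j ≡ j′
    bitP-inj refl = refl
    copyP-inj : ∀ {i j κ κ′} → right {NorGate} {PurGate} {OrcGate} (copyP i j κ) ≡ right (copyP i j κ′) → κ ≡ κ′
    copyP-inj refl = refl
    selector≢orc : ∀ i l {g} → selector i l ≢ orc g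
    selector≢orc i l e with i ≟ l
    selector≢orc i l () | yes _
    selector≢orc i l () | no _
    selector≢copy : ∀ i l {l′ j κ} → selector i l ≢ left (copyP l′ j κ)
    selector≢copy i l e with i ≟ l
    selector≢copy i l () | yes _
    selector≢copy i l () | no _
    selector-inj : ∀ i l l′ → selector i l ≡ selector i l′ → l ≡ l′
    selector-inj i l l′ e with i ≟ l | i ≟ l′
    selector-inj i l l′ e    | yes p | yes p′ = trans (sym p) p′
    selector-inj i l l′ refl | no _  | no _   = refl
    selector-inj i l l′ ()   | yes _ | no _
    selector-inj i l l′ ()   | no _  | yes _
    orcIn-inj : ∀ g x y → orcIn g x ≡ orcIn g y → x ≡ y
    orcIn-inj (i , _) (inj₁ l) (inj₁ l′) e = cong inj₁ (selector-inj i l l′ e)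
    orcIn-inj (i , _) (inj₁ l) (inj₂ _) e = ⊥-elim (selector≢copy i l e)
    orcIn-inj (i , _) (inj₂ _) (inj₁ l) e = ⊥-elim (selector≢copy i l (sym e))
    orcIn-inj (i , _) (inj₂ _) (inj₂ _) refl = refl

  module Semantics (val : Nd → Val)
    (nor-ok : ∀ g → NorSem (val (norL g)) (val (norR g)) (val (nor g)))
    (pur-ok : ∀ g → PurSem (val (purIn g)) (val (left g)) (val (right g)))
    (Answer : OrcGate → (Slot → Bool) → Bool)
    (orc-ok : ∀ g xs → (∀ j → val (orcIn g j) ≡ bit (xs j)) → val (orc g) ≡ bit (Answer g xs))
    where

    -- The seed itself may be v⊥, but one of its purified copies t is a bit, and then t NOR (NOT t) is 0.
    live : ∀ t x → val (seed t) ≡ bit x → val (nor (liveG t)) ≡ v1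
    live t x e = proj₁ (nor-ok (liveG t)) (proj₁ twins) (proj₂ twins)
      where
      s = proj₂ (pur-ok (splitP t)) x e
      dead : ∀ x → val (seed t) ≡ bit x → val (left (splitP t)) ≡ bit x × val (right (splitP t)) ≡ bit x →
        val (nor (deadG t)) ≡ v0
      dead false e (l , r) = proj₂ (nor-ok (deadG t)) (inj₂ (proj₁ (nor-ok (notG t)) l r))
      dead true  e (l , r) = proj₂ (nor-ok (deadG t)) (inj₁ e)
      twins = proj₂ (pur-ok (deadP t)) false (dead x e s)

    zero-val : val (nor zeroG) ≡ v0
    zero-val with proj₁ (pur-ok seedP)
    ... | inj₁ p = proj₂ (nor-ok zeroG) (inj₁ (live false _ (isBit-≡ p)))
    ... | inj₂ p = proj₂ (nor-ok zeroG) (inj₂ (live true _ (isBit-≡ p)))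

    pur-chain : ∀ {m} (s : Nd) (g : Fin m → PurGate) → (∀ k → purIn (g k) ≡ prev s (right ∘ g) k) →
      ∀ k → PurSem (prev (val s) (val ∘ right ∘ g) k) (val (left (g k))) (val (right (g k)))
    pur-chain s g e k = subst (λ n → PurSem n (val (left (g k))) (val (right (g k))))
      (trans (cong val (e k)) (prev-∘ val s (right ∘ g) k)) (pur-ok (g k))

    zeros : ∀ l → val (left (zeroP l)) ≡ v0
    zeros = purify-pure (pur-chain (nor zeroG) (λ l → zeroP l) (λ _ → refl)) {false} zero-val

    one-val : val (nor oneG) ≡ v1
    one-val = proj₁ (nor-ok oneG) (zeros zero) zero-val

    selector-val : ∀ i l → val (selector i l) ≡ bit (does (i ≟ l))
    selector-val i l with i ≟ l
    ... | yes _ = one-val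
    ... | no _  = zeros l

    row : ∀ i g → NorChain v0 (val ∘ feed i g) (λ k → val (nor (norG i g k))) (λ k → val (nor (orG i g k)))
    row i g = record
      { nor-step = λ k → subst (λ n → NorSem n (val (feed i g k)) (val (nor (norG i g k)))) (start k) (nor-ok (norG i g k))
      ; not-step = λ k → subst (λ z → NorSem (val (nor (norG i g k))) z (val (nor (orG i g k)))) zero-val (nor-ok (orG i g k))
      }
      where
      start : ∀ k → val (norL (norG i g k)) ≡ prev v0 (λ k → val (nor (orG i g k))) k
      start zero    = zero-val
      start (suc k) = refl

    bits-chain : ∀ i k → PurSem _ _ _
    bits-chain i = pur-chain (u i) (λ j → bitP i j) (λ _ → refl)

    copies-chain : ∀ i j k → PurSem _ _ _
    copies-chain i j = pur-chain (left (bitP i j)) (λ κ → copyP i j κ) (λ _ → refl)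

    bad-bit : Fin D → Fin 5
    bad-bit i = proj₁ (purify-one-bad (bits-chain i))

    -- A pure bit has only pure copies, so impure copies of coordinate i can stem only from its bad
    -- bit, whose own chain spoils at most one.
    bad-copy : Fin D → Fin K
    bad-copy i = proj₁ (purify-one-bad (copies-chain i (bad-bit i)))

    copy : Fin M × Fin M → Fin D → Fin 5 → Val
    copy (g , h) i j = val (left (copyP i j (combine g h)))

    Good : Fin M × Fin M → Set
    Good (g , h) = ∀ i → combine g h ≢ bad-copy i

    good-copy : ∀ {x} → Good x → ∀ i j → IsBit (copy x i j)
    good-copy good i j with j ≟ bad-bit i
    ... | yes refl = proj₂ (purify-one-bad (copies-chain i (bad-bit i))) _ (good i)
    ... | no ne    = bit-isBit (purify-pure (copies-chain i j) (isBit-≡ (proj₂ (purify-one-bad (bits-chain i)) j ne)) _)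

    X : Set
    X = Σ[ x ∈ Fin M × Fin M ] Good x

    bits : X → Fin D → Fin 5 → Bool
    bits (x , _) i j = toBool (copy x i j)

    -- A bit that is pure before copying is the same in all copies; this makes any two points of the
    -- cluster near.
    bits-agree : ∀ x y i j → j ≢ bad-bit i → bits x i j ≡ bits y i j
    bits-agree x y i j ne = trans (toBool-bit _ (same x)) (sym (toBool-bit _ (same y)))
      where
      same : ∀ (x : X) → copy (proj₁ x) i j ≡ bit (toBool (val (left (bitP i j))))
      same x = purify-pure (copies-chain i j) (isBit-≡ (proj₂ (purify-one-bad (bits-chain i)) j ne)) _

    slots : X → Fin D → Slot → Bool
    slots x i (inj₁ l)       = does (i ≟ l)
    slots x i (inj₂ (l , j)) = bits x l j

    answer : X → Fin D → Bool
    answer x@((g , h) , _) i = Answer (i , g , h) (slots x i)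

    slots-val : ∀ (x : X) i j → val (orcIn (i , proj₁ x) j) ≡ bit (slots x i j)
    slots-val x            i (inj₁ l)       = selector-val i l
    slots-val (x , good)   i (inj₂ (l , j)) = isBit-≡ (good-copy {x} good l j)

    answer-val : ∀ (x : X) i → val (orc (i , proj₁ x)) ≡ bit (answer x i)
    answer-val x i = orc-ok (i , proj₁ x) (slots x i) (slots-val x i)

    clean-row : ∃[ g ] ∀ i → g ≢ proj₁ (remQuot {M} M (bad-copy i))
    clean-row = missed _

    clean-column : ∃[ h ] ∀ i → h ≢ proj₂ (remQuot {M} M (bad-copy i))
    clean-column = missed _

    in-clean-row : Fin M → X
    in-clean-row h = (proj₁ clean-row , h) , λ i e → proj₂ clean-row i
      (trans (cong proj₁ (sym (remQuot-combine (proj₁ clean-row) h))) (cong (proj₁ ∘ remQuot M) e))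

    in-clean-column : Fin M → X
    in-clean-column g = (g , proj₁ clean-column) , λ i e → proj₂ clean-column i
      (trans (cong proj₂ (sym (remQuot-combine g (proj₁ clean-column)))) (cong (proj₂ ∘ remQuot M) e))

    u-val : ∀ i c → (∀ x → answer x i ≡ c) → val (u i) ≡ bit c
    u-val i true  h = chain-silent (row i zero) refl λ g → chain-fires (row i (suc g))
      (inj₂ (proj₁ clean-column , trans (answer-val (in-clean-column g) i) (cong bit (h _))))
    u-val i false h = chain-fires (row i zero) (inj₂ (proj₁ clean-row , chain-silent (row i (suc (proj₁ clean-row))) refl
      λ k → trans (answer-val (in-clean-row k) i) (cong bit (h _))))

    bits-val : ∀ i c → (∀ x → answer x i ≡ c) → ∀ x j → bits x i j ≡ c
    bits-val i c h x j = toBool-bit c (purify-pure (copies-chain i j) (purify-pure (bits-chain i) (u-val i c h) j) _)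

-- Decoding oracle inputs and counting gates

count : ∀ {m} → (Fin m → Bool) → ℕ
count {zero}  f = 0
count {suc m} f with f zero
... | true  = suc (count (f ∘ suc))
... | false = count (f ∘ suc)

count-cong : ∀ {m} {f g : Fin m → Bool} → (∀ j → f j ≡ g j) → count f ≡ count g
count-cong {zero}  e = refl
count-cong {suc m} {f} {g} e with f zero | g zero | e zero
... | true  | true  | refl = cong suc (count-cong (e ∘ suc))
... | false | false | refl = count-cong (e ∘ suc)

count-near : ∀ {m} {f g : Fin m → Bool} j₀ → (∀ j → j ≢ j₀ → f j ≡ g j) → count f ≤ suc (count g)
count-near {f = f} {g} zero e with f zero | g zero | count-cong {f = f ∘ suc} {g ∘ suc} (λ j → e (suc j) λ ())
... | true  | true  | eq = s≤s (m≤n⇒m≤1+n (≤-reflexive eq))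
... | true  | false | eq = s≤s (≤-reflexive eq)
... | false | true  | eq = m≤n⇒m≤1+n (m≤n⇒m≤1+n (≤-reflexive eq))
... | false | false | eq = m≤n⇒m≤1+n (≤-reflexive eq)
count-near {f = f} {g} (suc j₀) e
  with f zero | g zero | e zero (λ ()) | count-near {f = f ∘ suc} {g ∘ suc} j₀ (λ j ne → e (suc j) (ne ∘ suc-injective))
... | true  | true  | refl | le = s≤s le
... | false | false | refl | le = le

count-const : ∀ c {f : Fin 5 → Bool} → (∀ j → f j ≡ c) → count f ≡ ext c
count-const true  e = count-cong {g = λ _ → true} e
count-const false e = count-cong {g = λ _ → false} e

fin⊎ : ∀ {A B : Set} {m n} → A ↔ Fin m → B ↔ Fin n → (A ⊎ B) ↔ Fin (m + n)
fin⊎ i j = ↔-trans (i ⊎-↔ j) (↔-sym +↔⊎)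

fin× : ∀ {A B : Set} {m n} → A ↔ Fin m → B ↔ Fin n → (A × B) ↔ Fin (m * n)
fin× i j = ↔-trans (i ×-↔ j) (↔-sym *↔×)

fin : ∀ {m} → Fin m ↔ Fin m
fin = ↔-refl

bool : Bool ↔ Fin 2
bool = ↔-sym 2↔Bool

node-sum : ∀ {A P O : Set} → Node A P O ↔ (A ⊎ P ⊎ P ⊎ O)
node-sum = mk↔ₛ′
  (λ { (nor g) → inj₁ g ; (left g) → inj₂ (inj₁ g) ; (right g) → inj₂ (inj₂ (inj₁ g)) ; (orc g) → inj₂ (inj₂ (inj₂ g)) })
  (λ { (inj₁ g) → nor g ; (inj₂ (inj₁ g)) → left g ; (inj₂ (inj₂ (inj₁ g))) → right g ; (inj₂ (inj₂ (inj₂ g))) → orc g })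
  (λ { (inj₁ g) → refl ; (inj₂ (inj₁ g)) → refl ; (inj₂ (inj₂ (inj₁ g))) → refl ; (inj₂ (inj₂ (inj₂ g))) → refl })
  (λ { (nor g) → refl ; (left g) → refl ; (right g) → refl ; (orc g) → refl })

-- In `coreSize` the purify gates are counted twice, as each owns two nodes.
purifySize oracleSize coreSize : ℕ → ℕ
purifySize d = 1 + (2 * 2 + (D + (D * 5 + D * (5 * (M * M)))))
  where
  D = suc d
  M = suc D
oracleSize d = suc d * ((2 + d) * (2 + d))
coreSize d = 2 + (3 * 2 + 2 * (D * (suc M * M))) + (purifySize d + (purifySize d + oracleSize d))
  where
  D = suc d
  M = suc D

module _ (q d : ℕ) where
  open Tally q d

  norGates↔ : NorGate ↔ Fin (q + (2 + (3 * 2 + 2 * (D * (suc M * M)))))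
  norGates↔ = fin⊎ fin (fin⊎ bool (fin⊎ (fin× fin bool) (fin× bool (fin× fin (fin× fin fin)))))

  purGates↔ : PurGate ↔ Fin (purifySize d)
  purGates↔ = fin⊎ fin (fin⊎ (fin× bool bool) (fin⊎ fin (fin⊎ (fin× fin fin) (fin× fin (fin× fin fin)))))

  orcGates↔ : OrcGate ↔ Fin (oracleSize d)
  orcGates↔ = fin× fin (fin× fin fin)

  slots↔ : Slot ↔ Fin (D + D * 5)
  slots↔ = fin⊎ fin (fin× fin fin)

  nodes↔ : Nd ↔ Fin (q + coreSize d)
  nodes↔ = subst (λ n → Nd ↔ Fin n) (+-assoc q _ _)
    (↔-trans node-sum (fin⊎ norGates↔ (fin⊎ purGates↔ (fin⊎ purGates↔ orcGates↔))))

module Coords (r : ℕ) where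

  decode : Fin (2 + (r + r)) → Coord r
  decode zero       = φ
  decode (suc zero) = ξ
  decode (suc (suc k)) with splitAt r k
  ... | inj₁ j = a j
  ... | inj₂ j = b j

  encode : Coord r → Fin (2 + (r + r))
  encode φ     = zero
  encode ξ     = suc zero
  encode (a j) = suc (suc (j ↑ˡ r))
  encode (b j) = suc (suc (r ↑ʳ j))

  decode-encode : ∀ c → decode (encode c) ≡ c
  decode-encode φ = refl
  decode-encode ξ = refl
  decode-encode (a j) rewrite splitAt-↑ˡ r j r = refl
  decode-encode (b j) rewrite splitAt-↑ʳ r r j = refl

module Encoding (r q : ℕ) where
  d : ℕ
  d = 1 + (r + r)

  open Tally q d
  open Coords r

  levels : (Slot → Bool) → Vec ℕ D
  levels f = tabulate λ l → count λ j → f (inj₂ (l , j))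

  point : Vec ℕ D → Point r
  point ls c = lookup ls (encode c)

  index : (Slot → Bool) → Fin D
  index f with any? (λ l → f (inj₁ l) ≟ᵇ true)
  ... | yes (l , _) = l
  -- An arbitrary value: the circuit's selectors always contain a one.
  ... | no _        = zero

  index-unique : ∀ f i → (∀ l → f (inj₁ l) ≡ does (i ≟ l)) → index f ≡ i
  index-unique f i e with any? (λ l → f (inj₁ l) ≟ᵇ true)
  ... | yes (l , fl) with i ≟ l | trans (sym fl) (e l)
  ...   | yes i≡l | _ = sym i≡l
  ...   | no _    | ()
  index-unique f i e | no none with i ≟ i | e i
  ...   | yes _ | fi = ⊥-elim (none (i , fi))
  ...   | no ne | _  = ⊥-elim (ne refl)

  module LowerBound {a p o n arity} (iA : NorGate ↔ Fin a) (iP : PurGate ↔ Fin p) (iO : OrcGate ↔ Fin o)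
    (iJ : Slot ↔ Fin arity) (iNode : Nd ↔ Fin n) where

    open Realize circuit iA iP iO iJ iNode (zero , zero , zero) public

    oracle : (S P : Vec Bool r → Vec Bool r) → Oracle arity
    oracle S P xs = label S P (point (levels (read xs))) (decode (index (read xs)))

    touched : Vec Bool arity → Vec Bool r
    touched xs = touch (point (levels (read xs)))

    module _ (𝒜 : QueryAlg arity (Assignment n)) (solves : Solves inst 𝒜) where

      no-evasion : ∀ {S P end} → Path S P end →
        ¬ (∀ x → x ∈ queried 𝒜 (oracle S P) → touched x ≢ end)
      no-evasion {S} {P} {end} path evades = Cluster.impossible path (in-clean-row zero) pt near sol avoid
        where
        L : Oracle arity
        L = oracle S P
        open Solution (solves L)
        open Semantics val nor-ok pur-ok (λ _ xs → L (inputBits xs)) orc-ok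
        lv : X → Vec ℕ D
        lv x = tabulate λ l → count (bits x l)
        pt : X → Point r
        pt x = point (lv x)
        levels-slots : ∀ x i → levels (read (inputBits (slots x i))) ≡ lv x
        levels-slots x i = tabulate-cong λ l → count-cong λ j → read-inputBits (slots x i) (inj₂ (l , j))
        answer-label : ∀ x i → answer x i ≡ label S P (pt x) (decode i)
        answer-label x i = cong₂ (λ ls l → label S P (point ls) (decode l)) (levels-slots x i)
          (index-unique (read (inputBits (slots x i))) i λ l → read-inputBits (slots x i) (inj₁ l))
        pt-count : ∀ x c → pt x c ≡ count (bits x (encode c))
        pt-count x c = lookup∘tabulate (λ l → count (bits x l)) (encode c)
        near : ∀ x y c → Near (pt x c) (pt y c)
        near x y c = subst₂ Near (sym (pt-count x c)) (sym (pt-count y c))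
          ( count-near (bad-bit (encode c)) (bits-agree x y (encode c))
          , count-near (bad-bit (encode c)) (bits-agree y x (encode c)) )
        sol : ∀ c s → (∀ x → label S P (pt x) c ≡ s) → ∀ x → pt x c ≡ ext s
        sol c s h x = trans (pt-count x c) (count-const s (bits-val (encode c) s
          (λ y → trans (answer-label y (encode c)) (trans (cong (label S P (pt y)) (decode-encode c)) (h y))) x))
        avoid : ∀ x → touch (pt x) ≢ end
        -- The gate of any coordinate would do, since `touched` ignores the selector.
        avoid x e = evades _ (inputs-queried 𝒜 solves L (zero , proj₁ x) (slots x zero) (slots-val x zero))
          (trans (cong (touch ∘ point) (levels-slots x zero)) e)

      lower-bound : ∃[ L ] 2 ^ r ≤ queries 𝒜 L
      lower-bound with evade 𝒜 _ initial initial-explored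
        where
        open Adversary oracle touched (λ S S′ P P′ x →
          label-cong {S = S} {S′} {P} {P′} (point (levels (read x))) (decode (index (read x))))
      ... | st , _ , _ , inj₁ many   = _ , many
      ... | st , _ , _ , inj₂ evades = ⊥-elim (no-evasion (PathState.path st) evades)

-- Fitting the circuit to a given number of nodes

largest : (f : ℕ → ℕ) → ℕ → ℕ → ℕ
largest f n zero    = 0
largest f n (suc k) with f (suc k) ≤? n
... | yes _ = suc k
... | no _  = largest f n k

largest-sound : ∀ (f : ℕ → ℕ) n k → f 0 ≤ n → f (largest f n k) ≤ n
largest-sound f n zero    f0≤ = f0≤
largest-sound f n (suc k) f0≤ with f (suc k) ≤? n
... | yes le = le
... | no _   = largest-sound f n k f0≤

largest-max : ∀ (f : ℕ → ℕ) n k m → m ≤ k → f m ≤ n → m ≤ largest f n k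
largest-max f n zero    m m≤k fm≤ = m≤k
largest-max f n (suc k) m m≤k fm≤ with f (suc k) ≤? n
... | yes _  = m≤k
... | no nle = largest-max f n k m (≤-pred (≤∧≢⇒< m≤k λ { refl → nle fm≤ })) fm≤

-- The size grows like 13 D³, about 104 r³. For r = 1 it is 1406, between 11³ and 12³, whence the
-- factor 12. For r = 0 the cube vanishes, so this case needs its own bound.
coreSize-cubic : ∀ r n → coreSize 1 ≤ n → (12 * r) ^ 3 ≤ n → coreSize (1 + (r + r)) ≤ n
coreSize-cubic zero    n base _  = base
coreSize-cubic (suc s) n _    le = ≤-trans (m≤m+n _ _) (≤-trans (≤-reflexive (identity s)) le)
  where
  identity : ∀ s →
    let D = 2 + (suc s + suc s)
        M = 1 + D
        p = 1 + (2 * 2 + (D + (D * 5 + D * (5 * (M * M)))))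
    in 2 + (3 * 2 + 2 * (D * ((1 + M) * M))) + (p + (p + D * (M * M)))
         -- The difference of the two sides at r = 1 + s; its coefficients are nonnegative.
         + (322 + 3434 * s + 4448 * (s * s) + 1624 * (s * s * s))
       ≡ 12 * suc s * (12 * suc s * (12 * suc s * 1))
  identity = solve-∀

m≤[12m]³ : ∀ m → m ≤ (12 * m) ^ 3
m≤[12m]³ zero    = z≤n
m≤[12m]³ (suc m) = ≤-trans (m≤m+n (suc m) _) (m≤m*n (12 * suc m) ((12 * suc m) ^ 2))

mainTheorem3 : Σ ℕ λ k → Σ ℕ λ n₀ →
    (n : ℕ) → n₀ ≤ n →
    Σ ℕ λ N → Σ (Instance n N) λ I → WellFormed I ×
    ((A : QueryAlg N (Assignment n)) → Solves I A →
    (m : ℕ) → (suc k * m) ^ 3 ≤ n →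
    ∃ λ (L : Oracle N) → 2 ^ m ≤ queries A L)
-- The threshold is the size of the circuit for r = 0, so some circuit always fits.
mainTheorem3 = 11 , coreSize 1 , λ n n₀≤n →
  let cubic = λ m → (12 * m) ^ 3
      r     = largest cubic n n
      d     = 1 + (r + r)
      fits  = coreSize-cubic r n n₀≤n (largest-sound cubic n n z≤n)
      q     = n ∸ coreSize d
      sized = subst (λ n → Tally.Nd q d ↔ Fin n) (m∸n+n≡m fits) (nodes↔ q d)
      module R = Encoding.LowerBound r q (norGates↔ q d) (purGates↔ q d) (orcGates↔ q d) (slots↔ q d) sized
  in _ , R.inst , R.wellFormed , λ 𝒜 solves m m≤ →
    let L , many = R.lower-bound 𝒜 solves
    -- Since m ≤ (12 m)³ ≤ n, the search for r up to n has considered m, and r was chosen maximal.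
    in L , ≤-trans (^-monoʳ-≤ 2 (largest-max cubic n n m (≤-trans (m≤[12m]³ m) m≤) m≤)) many
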